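{- Let $\sigma$ be a list of three complex numbers such that $\rho(\sigma)>0$ and $\rho(\sigma)$ occurs in $\sigma$ with multiplicity exactly $1$. If $\sigma$ is not of the form $\{a,b,-a\}$ with $a>b>0$, then $\sigma$ is $\mathcal{IR}$ if and only if $\sigma$ is $\mathcal{R}$. If $\sigma=\{a,b,-a\}$ with $a>b>0$, then $\sigma$ is not $\mathcal{IR}$. In particular, if the sum of the elements of $\sigma$ is $0$, then $\sigma$ is $\mathcal{IR}$ if and only if $\sigma$ is $\mathcal{R}$.
   Context: For a list $\sigma$ of $n$ complex numbers (repeats allowed), $\rho(\sigma)$ denotes the largest absolute value of an element of $\sigma$. The list $\sigma$ is realizable ($\mathcal{R}$) if there is an $n\times n$ entrywise nonnegative matrix whose list of eigenvalues, with multiplicities, is $\sigma$; it is irreducibly realizable ($\mathcal{IR}$) if such a matrix can be chosen irreducible. A square matrix is irreducible if it is not similar by a permutation matrix to a nontrivially block triangular matrix (equivalently, its digraph is strongly connected). -}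

module Defs where

open import Algebra.Bundles using (CommutativeRing)
import Algebra.Construct.NaturalChoice.Max as NaturalMax
import Algebra.Properties.Ring as RingProperties
import Algebra.Properties.Semiring.Exp as Exp
import Algebra.Properties.Semiring.Sum as Sum
import Algebra.Solver.Ring.NaturalCoefficients.Default as NatSolver
open import Data.Bool.Base using (if_then_else_)
open import Data.Fin.Base using (Fin; zero; suc; toℕ; punchIn)
open import Data.Fin.Permutation using (Permutation′; _⟨$⟩ʳ_)
import Data.Fin.Properties as Fin
open import Data.List.Base using (List; []; _∷_; length; filter; foldr; map)
import Data.List.Relation.Binary.Permutation.Setoid as PermutationSetoid
open import Data.Nat.Base as ℕ using (ℕ)
open import Data.Product.Base using (∃; ∃-syntax; _×_; _,_; proj₁; proj₂)
open import Data.Sum.Base using (inj₁; inj₂)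
open import Level using (0ℓ)
open import Relation.Binary.Bundles using (DecTotalOrder)
open import Relation.Binary.Core using (Rel)
open import Relation.Binary.Definitions using (Decidable)
import Relation.Binary.Construct.NonStrictToStrict as ToStrict
import Relation.Binary.Reasoning.Setoid as SetoidReasoning
open import Relation.Binary.Structures using (IsDecTotalOrder)
open import Relation.Nullary using (¬_; yes; no; does; contradiction)
open import Relation.Nullary.Decidable using (_×-dec_)
open import Relation.Unary using (Pred)

-- The standard library has no real numbers, so ℝ is a variable ranging over
-- the models of its usual axioms, which determine it up to isomorphism.  The
-- order is decidable because the axioms are those of classical mathematics.
record CompleteOrderedField : Set₁ where
  infix 4 _≤_
  field
    commutativeRing : CommutativeRing 0ℓ 0ℓ

  open CommutativeRing commutativeRing public
    hiding (_≉_)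

  field
    _≤_             : Rel Carrier 0ℓ
    isDecTotalOrder : IsDecTotalOrder _≈_ _≤_
    +-monoˡ-≤       : ∀ {x y} z → x ≤ y → x + z ≤ y + z
    *-nonNegative   : ∀ {x y} → 0# ≤ x → 0# ≤ y → 0# ≤ x * y
    0≉1             : ¬ 0# ≈ 1#
    inverse         : ∀ x → ¬ x ≈ 0# → ∃[ y ] x * y ≈ 1#

  UpperBound : Pred Carrier 0ℓ → Pred Carrier 0ℓ
  UpperBound P u = ∀ x → P x → x ≤ u

  IsSupremum : Pred Carrier 0ℓ → Pred Carrier 0ℓ
  IsSupremum P s = UpperBound P s × (∀ u → UpperBound P u → s ≤ u)

  field
    complete : ∀ P → ∃ P → ∃ (UpperBound P) → ∃ (IsSupremum P)

  decTotalOrder : DecTotalOrder 0ℓ 0ℓ 0ℓ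
  decTotalOrder = record { isDecTotalOrder = isDecTotalOrder }

  open DecTotalOrder decTotalOrder public
    using (totalOrder; _≟_; _≤?_; total; antisym)
    renaming ( refl to ≤-refl; reflexive to ≤-reflexive; trans to ≤-trans
             ; ≤-respʳ-≈ to ≤-respʳ; ≤-respˡ-≈ to ≤-respˡ )

  infix 4 _<_
  _<_ : Rel Carrier 0ℓ
  _<_ = ToStrict._<_ _≈_ _≤_

module SquareRoot (ℝ : CompleteOrderedField) where
  open CompleteOrderedField ℝ
  open SetoidReasoning setoid
  open RingProperties ring using (-‿distribˡ-*; -‿distribʳ-*; -‿involutive)
  private
    module S = NatSolver commutativeSemiring
  open S using (_:+_; _:*_; _:=_; con)

  x≤y⇒0≤y-x : ∀ {x y} → x ≤ y → 0# ≤ y - x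
  x≤y⇒0≤y-x {x} x≤y = ≤-respˡ (-‿inverseʳ x) (+-monoˡ-≤ (- x) x≤y)

  y≈x+d⇒x≤y : ∀ {x y} d → 0# ≤ d → x + d ≈ y → x ≤ y
  y≈x+d⇒x≤y {x} d 0≤d x+d≈y =
    ≤-respʳ (trans (+-comm d x) x+d≈y) (≤-respˡ (+-identityˡ x) (+-monoˡ-≤ x 0≤d))

  x+[y-x]≈y : ∀ x y → x + (y - x) ≈ y
  x+[y-x]≈y x y = begin
    x + (y - x)  ≈⟨ S.solve 3 (λ x y n → x :+ (y :+ n) := y :+ (x :+ n)) refl x y (- x) ⟩
    y + (x - x)  ≈⟨ +-congˡ (-‿inverseʳ x) ⟩
    y + 0#       ≈⟨ +-identityʳ y ⟩
    y            ∎

  +-nonNegative : ∀ {x y} → 0# ≤ x → 0# ≤ y → 0# ≤ x + y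
  +-nonNegative {x} {y} 0≤x 0≤y =
    ≤-trans 0≤x (y≈x+d⇒x≤y y 0≤y refl)

  x≤0⇒0≤-x : ∀ {x} → x ≤ 0# → 0# ≤ - x
  x≤0⇒0≤-x x≤0 = ≤-respʳ (+-identityˡ _) (x≤y⇒0≤y-x x≤0)

  -x*-x≈x*x : ∀ x → - x * - x ≈ x * x
  -x*-x≈x*x x = begin
    - x * - x    ≈⟨ -‿distribˡ-* x (- x) ⟨
    - (x * - x)  ≈⟨ -‿cong (sym (-‿distribʳ-* x x)) ⟩
    - - (x * x)  ≈⟨ -‿involutive (x * x) ⟩
    x * x        ∎

  0≤x*x : ∀ x → 0# ≤ x * x
  0≤x*x x with total 0# x
  ... | inj₁ 0≤x = *-nonNegative 0≤x 0≤x
  ... | inj₂ x≤0 = ≤-respʳ (-x*-x≈x*x x) (*-nonNegative (x≤0⇒0≤-x x≤0) (x≤0⇒0≤-x x≤0))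

  0≤1 : 0# ≤ 1#
  0≤1 = ≤-respʳ (*-identityˡ 1#) (0≤x*x 1#)

  +-zero⇒zero : ∀ {x y} → 0# ≤ x → 0# ≤ y → x + y ≈ 0# → x ≈ 0#
  +-zero⇒zero 0≤x 0≤y x+y≈0 = antisym (y≈x+d⇒x≤y _ 0≤y x+y≈0) 0≤x

  *-zero⇒zero : ∀ {x y} → ¬ x ≈ 0# → x * y ≈ 0# → y ≈ 0#
  *-zero⇒zero {x} {y} x≉0 xy≈0 with inverse x x≉0
  ... | u , xu≈1 = begin
    y            ≈⟨ *-identityˡ y ⟨
    1# * y       ≈⟨ *-congʳ xu≈1 ⟨
    x * u * y    ≈⟨ S.solve 3 (λ x u y → x :* u :* y := u :* (x :* y)) refl x u y ⟩
    u * (x * y)  ≈⟨ *-congˡ xy≈0 ⟩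
    u * 0#       ≈⟨ zeroʳ u ⟩
    0#           ∎

  inverse-nonNegative : ∀ {x u} → 0# ≤ x → x * u ≈ 1# → 0# ≤ u
  inverse-nonNegative {x} {u} 0≤x xu≈1 with total 0# u
  ... | inj₁ 0≤u = 0≤u
  ... | inj₂ u≤0 = contradiction (antisym 0≤1 1≤0) 0≉1
    where
    1≤0 : 1# ≤ 0#
    1≤0 = y≈x+d⇒x≤y (x * - u) (*-nonNegative 0≤x (x≤0⇒0≤-x u≤0)) (begin
      1# + x * - u       ≈⟨ +-congʳ xu≈1 ⟨
      x * u + x * - u    ≈⟨ distribˡ x u (- u) ⟨
      x * (u - u)        ≈⟨ *-congˡ (-‿inverseʳ u) ⟩
      x * 0#             ≈⟨ zeroʳ x ⟩
      0#                 ∎)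

  square-reflects-≤ : ∀ {x y} → 0# ≤ x → 0# ≤ y → x * x ≤ y * y → x ≤ y
  square-reflects-≤ {x} {y} 0≤x 0≤y x²≤y² with total x y
  ... | inj₁ x≤y = x≤y
  ... | inj₂ y≤x with x + y ≟ 0#
  ...   | yes x+y≈0 = ≤-trans (≤-reflexive (+-zero⇒zero 0≤x 0≤y x+y≈0)) 0≤y
  ...   | no  x+y≉0 = ≤-reflexive (begin
    x        ≈⟨ x+[y-x]≈y y x ⟨
    y + d    ≈⟨ +-congˡ (*-zero⇒zero x+y≉0 (antisym [x+y]d≤0 0≤[x+y]d)) ⟩
    y + 0#   ≈⟨ +-identityʳ y ⟩
    y        ∎)
    where
    d = x - y
    0≤[x+y]d : 0# ≤ (x + y) * d
    0≤[x+y]d = *-nonNegative (+-nonNegative 0≤x 0≤y) (x≤y⇒0≤y-x y≤x)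
    y²+[x+y]d≈x² : y * y + (x + y) * d ≈ x * x
    y²+[x+y]d≈x² = begin
      y * y + (x + y) * d  ≈⟨ +-congˡ (distribʳ d x y) ⟩
      y * y + (x * d + y * d)
        ≈⟨ S.solve 3 (λ x y d → y :* y :+ (x :* d :+ y :* d) := y :* (y :+ d) :+ x :* d) refl x y d ⟩
      y * (y + d) + x * d  ≈⟨ +-congʳ (*-congˡ (x+[y-x]≈y y x)) ⟩
      y * x + x * d        ≈⟨ S.solve 3 (λ x y d → y :* x :+ x :* d := x :* (y :+ d)) refl x y d ⟩
      x * (y + d)          ≈⟨ *-congˡ (x+[y-x]≈y y x) ⟩
      x * x                ∎
    [x+y]d≤0 : (x + y) * d ≤ 0#
    [x+y]d≤0 = ≤-respʳ (-‿inverseʳ (y * y))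
      (≤-respˡ cancel (+-monoˡ-≤ (- (y * y)) (≤-respˡ (sym y²+[x+y]d≈x²) x²≤y²)))
      where
      cancel : y * y + (x + y) * d - y * y ≈ (x + y) * d
      cancel = begin
        y * y + (x + y) * d - y * y
          ≈⟨ S.solve 3 (λ a b c → a :+ b :+ c := b :+ (a :+ c)) refl (y * y) ((x + y) * d) (- (y * y)) ⟩
        (x + y) * d + (y * y - y * y)  ≈⟨ +-congˡ (-‿inverseʳ (y * y)) ⟩
        (x + y) * d + 0#               ≈⟨ +-identityʳ _ ⟩
        (x + y) * d                    ∎

  factor-zero⇒zero : ∀ {d e} → 0# ≤ e → e ≤ 0# → ∀ {v} → v * e ≈ d → d ≈ 0#
  factor-zero⇒zero 0≤e e≤0 {v} ve≈d =
    trans (sym ve≈d) (trans (*-congˡ (antisym e≤0 0≤e)) (zeroʳ v))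

  SquareAtMost : Carrier → Pred Carrier 0ℓ
  SquareAtMost x y = 0# ≤ y × y * y ≤ x

  upper⇒x≤r² : ∀ {x r} → 0# ≤ r → UpperBound (SquareAtMost x) r → x ≤ r * r
  upper⇒x≤r² {x} {r} 0≤r upper with total x (r * r)
  ... | inj₁ x≤r² = x≤r²
  ... | inj₂ r²≤x = ≤-reflexive (begin
    x            ≈⟨ x+[y-x]≈y (r * r) x ⟨
    r * r + d    ≈⟨ +-congˡ d≈0 ⟩
    r * r + 0#   ≈⟨ +-identityʳ _ ⟩
    r * r        ∎)
    where
    d = x - r * r
    0≤d : 0# ≤ d
    0≤d = x≤y⇒0≤y-x r²≤x
    w = r + r + d
    0≤w : 0# ≤ w
    0≤w = +-nonNegative (+-nonNegative 0≤r 0≤r) 0≤d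
    v = 1# + w
    0≤v : 0# ≤ v
    0≤v = +-nonNegative 0≤1 0≤w
    v≉0 : ¬ v ≈ 0#
    v≉0 v≈0 = 0≉1 (sym (+-zero⇒zero 0≤1 0≤w v≈0))
    u = proj₁ (inverse v v≉0)
    vu≈1 : v * u ≈ 1#
    vu≈1 = proj₂ (inverse v v≉0)
    0≤u : 0# ≤ u
    0≤u = inverse-nonNegative 0≤v vu≈1
    e = u * d
    0≤e : 0# ≤ e
    0≤e = *-nonNegative 0≤u 0≤d
    ve≈d : v * e ≈ d
    ve≈d = begin
      v * (u * d)  ≈⟨ *-assoc v u d ⟨
      v * u * d    ≈⟨ *-congʳ vu≈1 ⟩
      1# * d       ≈⟨ *-identityˡ d ⟩
      d            ∎
    1≈e+t : 1# ≈ e + u * (1# + r + r)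
    1≈e+t = begin
      1#     ≈⟨ vu≈1 ⟨
      v * u  ≈⟨ S.solve 3 (λ r d u → (con 1 :+ (r :+ r :+ d)) :* u
                             := u :* d :+ u :* (con 1 :+ r :+ r)) refl r d u ⟩
      e + u * (1# + r + r) ∎
    t = u * (1# + r + r)
    0≤t : 0# ≤ t
    0≤t = *-nonNegative 0≤u (+-nonNegative (+-nonNegative 0≤1 0≤r) 0≤r)
    gap : (r + e) * (r + e) + e * (d + t) ≈ x
    gap = begin
      (r + e) * (r + e) + e * (d + t)
        ≈⟨ S.solve 4 (λ r e d t → (r :+ e) :* (r :+ e) :+ e :* (d :+ t)
             := r :* r :+ ((r :+ r :+ d) :* e :+ e :* (e :+ t))) refl r e d t ⟩
      r * r + (w * e + e * (e + t))
        ≈⟨ +-congˡ (+-congˡ (*-congˡ 1≈e+t)) ⟨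
      r * r + (w * e + e * 1#)
        ≈⟨ +-congˡ (S.solve 2 (λ w e → w :* e :+ e :* con 1 := (con 1 :+ w) :* e) refl w e) ⟩
      r * r + v * e    ≈⟨ +-congˡ ve≈d ⟩
      r * r + d        ≈⟨ x+[y-x]≈y (r * r) x ⟩
      x                ∎
    r+e∈P : SquareAtMost x (r + e)
    r+e∈P = +-nonNegative 0≤r 0≤e
          , y≈x+d⇒x≤y _ (*-nonNegative 0≤e (+-nonNegative 0≤d 0≤t)) gap
    e≤0 : e ≤ 0#
    e≤0 = ≤-respʳ (-‿inverseʳ r)
      (≤-respˡ (begin
        r + e - r    ≈⟨ S.solve 3 (λ r e n → r :+ e :+ n := e :+ (r :+ n)) refl r e (- r) ⟩
        e + (r - r)  ≈⟨ +-congˡ (-‿inverseʳ r) ⟩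
        e + 0#       ≈⟨ +-identityʳ e ⟩
        e            ∎)
      (+-monoˡ-≤ (- r) (upper (r + e) r+e∈P)))
    d≈0 : d ≈ 0#
    d≈0 = factor-zero⇒zero 0≤e e≤0 ve≈d

  least⇒r²≤x : ∀ {x r} → 0# ≤ x → 0# ≤ r →
    (∀ s → UpperBound (SquareAtMost x) s → r ≤ s) → r * r ≤ x
  least⇒r²≤x {x} {r} 0≤x 0≤r least with total (r * r) x | r + r ≟ 0#
  ... | inj₁ r²≤x | _         = r²≤x
  ... | inj₂ _    | yes r+r≈0 = ≤-trans (≤-reflexive (begin
    r * r    ≈⟨ *-congˡ (+-zero⇒zero 0≤r 0≤r r+r≈0) ⟩
    r * 0#   ≈⟨ zeroʳ r ⟩
    0#       ∎)) 0≤x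
  ... | inj₂ x≤r² | no  v≉0   = ≤-reflexive (begin
    r * r   ≈⟨ x+[y-x]≈y x (r * r) ⟨
    x + d   ≈⟨ +-congˡ d≈0 ⟩
    x + 0#  ≈⟨ +-identityʳ x ⟩
    x       ∎)
    where
    d = r * r - x
    0≤d : 0# ≤ d
    0≤d = x≤y⇒0≤y-x x≤r²
    v = r + r
    u = proj₁ (inverse v v≉0)
    vu≈1 : v * u ≈ 1#
    vu≈1 = proj₂ (inverse v v≉0)
    0≤u : 0# ≤ u
    0≤u = inverse-nonNegative (+-nonNegative 0≤r 0≤r) vu≈1
    e = u * d
    0≤e : 0# ≤ e
    0≤e = *-nonNegative 0≤u 0≤d
    s = u * (r * r + x)
    0≤s : 0# ≤ s
    0≤s = *-nonNegative 0≤u (+-nonNegative (0≤x*x r) 0≤x)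
    ve≈d : v * e ≈ d
    ve≈d = begin
      v * (u * d)  ≈⟨ *-assoc v u d ⟨
      v * u * d    ≈⟨ *-congʳ vu≈1 ⟩
      1# * d       ≈⟨ *-identityˡ d ⟩
      d            ∎
    s+e≈r : s + e ≈ r
    s+e≈r = begin
      u * (r * r + x) + u * d
        ≈⟨ S.solve 4 (λ u r x d → u :* (r :* r :+ x) :+ u :* d
             := u :* (r :* r :+ (x :+ d))) refl u r x d ⟩
      u * (r * r + (x + d))  ≈⟨ *-congˡ (+-congˡ (x+[y-x]≈y x (r * r))) ⟩
      u * (r * r + r * r)    ≈⟨ S.solve 2 (λ u r → u :* (r :* r :+ r :* r)
                                  := (r :+ r) :* u :* r) refl u r ⟩
      v * u * r              ≈⟨ *-congʳ vu≈1 ⟩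
      1# * r                 ≈⟨ *-identityˡ r ⟩
      r                      ∎
    s² : x + e * e ≈ s * s
    s² = begin
      x + e * e                  ≈⟨ +-identityʳ _ ⟨
      x + e * e + 0#             ≈⟨ +-congˡ (-‿inverseʳ (v * e)) ⟨
      x + e * e + (v * e - v * e)
        ≈⟨ S.solve 4 (λ x q a n → x :+ q :+ (a :+ n) := x :+ a :+ q :+ n) refl x (e * e) (v * e) (- (v * e)) ⟩
      x + v * e + e * e - v * e  ≈⟨ +-congʳ (+-congʳ (trans (+-congˡ ve≈d) (x+[y-x]≈y x (r * r)))) ⟩
      r * r + e * e - v * e
        ≈⟨ +-congʳ (+-congʳ (*-cong s+e≈r s+e≈r)) ⟨
      (s + e) * (s + e) + e * e - v * e
        ≈⟨ +-congʳ (S.solve 2 (λ s e → (s :+ e) :* (s :+ e) :+ e :* e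
             := s :* s :+ ((s :+ e) :+ (s :+ e)) :* e) refl s e) ⟩
      s * s + ((s + e) + (s + e)) * e - v * e
        ≈⟨ +-congʳ (+-congˡ (*-congʳ (+-cong s+e≈r s+e≈r))) ⟩
      s * s + v * e - v * e      ≈⟨ +-assoc _ _ _ ⟩
      s * s + (v * e - v * e)    ≈⟨ +-congˡ (-‿inverseʳ (v * e)) ⟩
      s * s + 0#                 ≈⟨ +-identityʳ _ ⟩
      s * s                      ∎
    s-upper : UpperBound (SquareAtMost x) s
    s-upper y (0≤y , y²≤x) = square-reflects-≤ 0≤y 0≤s
      (≤-trans y²≤x (y≈x+d⇒x≤y (e * e) (0≤x*x e) s²))
    e≤0 : e ≤ 0#
    e≤0 = ≤-respʳ (-‿inverseʳ s) (≤-respˡ (begin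
        r - s          ≈⟨ +-congʳ s+e≈r ⟨
        s + e - s      ≈⟨ S.solve 3 (λ s e n → s :+ e :+ n := e :+ (s :+ n)) refl s e (- s) ⟩
        e + (s - s)    ≈⟨ +-congˡ (-‿inverseʳ s) ⟩
        e + 0#         ≈⟨ +-identityʳ e ⟩
        e              ∎)
      (+-monoˡ-≤ (- s) (least s s-upper)))
    d≈0 : d ≈ 0#
    d≈0 = factor-zero⇒zero 0≤e e≤0 ve≈d

  abstract
    √-exists : ∀ x → 0# ≤ x → ∃[ r ] (0# ≤ r × r * r ≈ x)
    √-exists x 0≤x with complete (SquareAtMost x) (0# , 0∈P) (1# + x , bounded)
      where
      0∈P : SquareAtMost x 0#
      0∈P = ≤-refl , ≤-respˡ (sym (zeroˡ 0#)) 0≤x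

      bounded : UpperBound (SquareAtMost x) (1# + x)
      bounded y (0≤y , y²≤x) = square-reflects-≤ 0≤y (+-nonNegative 0≤1 0≤x)
        (≤-trans y²≤x (y≈x+d⇒x≤y (1# + x + x * x)
          (+-nonNegative (+-nonNegative 0≤1 0≤x) (0≤x*x x))
          (S.solve 1 (λ x → x :+ (con 1 :+ x :+ x :* x) := (con 1 :+ x) :* (con 1 :+ x)) refl x)))
    ... | r , upper , least =
      r , 0≤r , antisym (least⇒r²≤x 0≤x 0≤r least) (upper⇒x≤r² 0≤r upper)
      where
      0≤r : 0# ≤ r
      0≤r = upper 0# (≤-refl , ≤-respˡ (sym (zeroˡ 0#)) 0≤x)

module ComplexNumbers (ℝ : CompleteOrderedField) where
  open CompleteOrderedField ℝ
  open SquareRoot ℝ using (√-exists; 0≤x*x; +-nonNegative)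
  private
    module S = NatSolver commutativeSemiring
  open S using (_:+_; _:*_; _:=_; con)

  infix 5 _+i_
  record ℂ : Set where
    constructor _+i_
    field
      re im : Carrier
  open ℂ public

  fromℝ : Carrier → ℂ
  fromℝ x = x +i 0#

  infix 4 _≈ℂ_ _≟ℂ_
  _≈ℂ_ : Rel ℂ 0ℓ
  z ≈ℂ w = re z ≈ re w × im z ≈ im w

  _≟ℂ_ : Decidable _≈ℂ_
  z ≟ℂ w = (re z ≟ re w) ×-dec (im z ≟ im w)

  infixl 6 _+ℂ_
  infixl 7 _*ℂ_
  infix  8 -ℂ_

  _+ℂ_ _*ℂ_ : ℂ → ℂ → ℂ
  (a +i b) +ℂ (c +i d) = (a + c) +i (b + d)
  (a +i b) *ℂ (c +i d) = (a * c - b * d) +i (a * d + b * c)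

  -ℂ_ : ℂ → ℂ
  -ℂ (a +i b) = (- a) +i (- b)

  private
    open SetoidReasoning setoid
    open RingProperties ring using (-1*x≈-x)
    n = - 1#

    minus : ∀ {p q q′} → q ≈ q′ → p - q ≈ p + n * q′
    minus q≈q′ = +-congˡ (trans (-‿cong q≈q′) (sym (-1*x≈-x _)))

    minus₀ : ∀ {p q} → p - q ≈ p + n * q
    minus₀ = minus refl

    *ℂ-assoc : ∀ x y z → (x *ℂ y) *ℂ z ≈ℂ x *ℂ (y *ℂ z)
    *ℂ-assoc (a +i b) (c +i d) (e +i f) =
      (begin
        (a * c - b * d) * e - (a * d + b * c) * f
          ≈⟨ +-cong (*-congʳ minus₀) (sym (-1*x≈-x _)) ⟩
        (a * c + n * (b * d)) * e + n * ((a * d + b * c) * f)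
          ≈⟨ S.solve 7 (λ n a b c d e f →
               (a :* c :+ n :* (b :* d)) :* e :+ n :* ((a :* d :+ b :* c) :* f)
               := a :* (c :* e :+ n :* (d :* f)) :+ n :* (b :* (c :* f :+ d :* e)))
               refl n a b c d e f ⟩
        a * (c * e + n * (d * f)) + n * (b * (c * f + d * e))
          ≈⟨ +-cong (*-congˡ minus₀) (sym (-1*x≈-x _)) ⟨
        a * (c * e - d * f) - b * (c * f + d * e) ∎)
      ,
      (begin
        (a * c - b * d) * f + (a * d + b * c) * e
          ≈⟨ +-congʳ (*-congʳ minus₀) ⟩
        (a * c + n * (b * d)) * f + (a * d + b * c) * e
          ≈⟨ S.solve 7 (λ n a b c d e f →
               (a :* c :+ n :* (b :* d)) :* f :+ (a :* d :+ b :* c) :* e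
               := a :* (c :* f :+ d :* e) :+ b :* (c :* e :+ n :* (d :* f)))
               refl n a b c d e f ⟩
        a * (c * f + d * e) + b * (c * e + n * (d * f))
          ≈⟨ +-congˡ (*-congˡ minus₀) ⟨
        a * (c * f + d * e) + b * (c * e - d * f) ∎)

    *ℂ-comm : ∀ x y → x *ℂ y ≈ℂ y *ℂ x
    *ℂ-comm (a +i b) (c +i d) =
      +-cong (*-comm a c) (-‿cong (*-comm b d)) ,
      S.solve 4 (λ a b c d → a :* d :+ b :* c := c :* b :+ d :* a) refl a b c d

    *ℂ-identityˡ : ∀ x → fromℝ 1# *ℂ x ≈ℂ x
    *ℂ-identityˡ (a +i b) =
      (begin
        1# * a - 0# * b       ≈⟨ minus (zeroˡ b) ⟩
        1# * a + n * 0#       ≈⟨ S.solve 2 (λ n a → con 1 :* a :+ n :* con 0 := a) refl n a ⟩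
        a                     ∎)
      , S.solve 2 (λ a b → con 1 :* b :+ con 0 :* a := b) refl a b

    distribʳℂ : ∀ x y z → (y +ℂ z) *ℂ x ≈ℂ (y *ℂ x) +ℂ (z *ℂ x)
    distribʳℂ (a +i b) (c +i d) (e +i f) =
      (begin
        (c + e) * a - (d + f) * b  ≈⟨ minus₀ ⟩
        (c + e) * a + n * ((d + f) * b)
          ≈⟨ S.solve 7 (λ n a b c d e f →
               (c :+ e) :* a :+ n :* ((d :+ f) :* b)
               := (c :* a :+ n :* (d :* b)) :+ (e :* a :+ n :* (f :* b)))
               refl n a b c d e f ⟩
        (c * a + n * (d * b)) + (e * a + n * (f * b))  ≈⟨ +-cong minus₀ minus₀ ⟨
        (c * a - d * b) + (e * a - f * b) ∎)
      ,
      S.solve 6 (λ a b c d e f →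
        (c :+ e) :* b :+ (d :+ f) :* a := (c :* b :+ d :* a) :+ (e :* b :+ f :* a))
        refl a b c d e f

    *ℂ-cong : ∀ {x y u v} → x ≈ℂ y → u ≈ℂ v → x *ℂ u ≈ℂ y *ℂ v
    *ℂ-cong (p , q) (r , s) =
      +-cong (*-cong p r) (-‿cong (*-cong q s)) , +-cong (*-cong p s) (*-cong q r)

    ≈ℂ-trans : ∀ {x y z} → x ≈ℂ y → y ≈ℂ z → x ≈ℂ z
    ≈ℂ-trans (p , q) (r , s) = trans p r , trans q s

  ℂ-commutativeRing : CommutativeRing 0ℓ 0ℓ
  ℂ-commutativeRing = record
    { Carrier = ℂ ; _≈_ = _≈ℂ_ ; _+_ = _+ℂ_ ; _*_ = _*ℂ_ ; -_ = -ℂ_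
    ; 0# = fromℝ 0# ; 1# = fromℝ 1#
    ; isCommutativeRing = record
      { isRing = record
        { +-isAbelianGroup = record
          { isGroup = record
            { isMonoid = record
              { isSemigroup = record
                { isMagma = record
                  { isEquivalence = record
                    { refl = refl , refl
                    ; sym = λ (p , q) → sym p , sym q
                    ; trans = ≈ℂ-trans
                    }
                  ; ∙-cong = λ (p , q) (r , s) → +-cong p r , +-cong q s
                  }
                ; assoc = λ _ _ _ → +-assoc _ _ _ , +-assoc _ _ _
                }
              ; identity = (λ _ → +-identityˡ _ , +-identityˡ _)
                         , (λ _ → +-identityʳ _ , +-identityʳ _)
              }
            ; inverse = (λ _ → -‿inverseˡ _ , -‿inverseˡ _)
                      , (λ _ → -‿inverseʳ _ , -‿inverseʳ _)
            ; ⁻¹-cong = λ (p , q) → -‿cong p , -‿cong q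
            }
          ; comm = λ _ _ → +-comm _ _ , +-comm _ _
          }
        ; *-cong = *ℂ-cong
        ; *-assoc = *ℂ-assoc
        ; *-identity = *ℂ-identityˡ
                     , (λ x → ≈ℂ-trans (*ℂ-comm x (fromℝ 1#)) (*ℂ-identityˡ x))
        ; distrib = (λ x y z → ≈ℂ-trans (*ℂ-comm x (y +ℂ z))
                      (≈ℂ-trans (distribʳℂ x y z)
                        (let (p , q) = *ℂ-comm y x ; (r , s) = *ℂ-comm z x
                         in +-cong p r , +-cong q s)))
                  , distribʳℂ
        }
      ; *-comm = *ℂ-comm
      }
    }

  ∣_∣ : ℂ → Carrier
  ∣ a +i b ∣ = proj₁ (√-exists (a * a + b * b) (+-nonNegative (0≤x*x a) (0≤x*x b)))

Matrix : Set → ℕ → Set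
Matrix A n = Fin n → Fin n → A

module Determinant (R : CommutativeRing 0ℓ 0ℓ) where
  open CommutativeRing R hiding (zero)
  open Sum semiring using (sum)
  open Exp semiring using (_^_)

  identityMatrix : ∀ {n} → Matrix Carrier n
  identityMatrix i j = if does (i Fin.≟ j) then 1# else 0#

  -- Laplace expansion along the first row.
  det : ∀ {n} → Matrix Carrier n → Carrier
  det {ℕ.zero}  A = 1#
  det {ℕ.suc n} A = sum λ j →
    (- 1#) ^ toℕ j * (A zero j * det (λ i k → A (suc i) (punchIn j k)))

module Spectra (ℝ : CompleteOrderedField) where
  open CompleteOrderedField ℝ
  open ComplexNumbers ℝ public
  open Determinant ℂ-commutativeRing
  open NaturalMax totalOrder using (_⊔_)
  open PermutationSetoid (CommutativeRing.setoid ℂ-commutativeRing) public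
    using (_↭_)

  -- The moduli are nonnegative, so starting the maximum at 0# is harmless.
  ρ : List ℂ → Carrier
  ρ σ = foldr _⊔_ 0# (map ∣_∣ σ)

  multiplicity : ℂ → List ℂ → ℕ
  multiplicity z σ = length (filter (_≟ℂ z) σ)

  sumℂ productℂ : List ℂ → ℂ
  sumℂ     = foldr _+ℂ_ (fromℝ 0#)
  productℂ = foldr _*ℂ_ (fromℝ 1#)

  -- det (z I - A)
  characteristicPolynomial : ∀ {n} → Matrix Carrier n → ℂ → ℂ
  characteristicPolynomial A z =
    det λ i j → z *ℂ identityMatrix i j +ℂ -ℂ fromℝ (A i j)

  -- σ lists the eigenvalues of A with their algebraic multiplicities.
  -- Equality of the two polynomials in z is equality of polynomial functions,
  -- since ℂ is infinite.
  HasEigenvalues : ∀ {n} → Matrix Carrier n → List ℂ → Set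
  HasEigenvalues A σ =
    ∀ z → characteristicPolynomial A z ≈ℂ productℂ (map (λ μ → z +ℂ -ℂ μ) σ)

  Nonnegative : ∀ {n} → Matrix Carrier n → Set
  Nonnegative A = ∀ i j → 0# ≤ A i j

  -- The simultaneous permutation of rows and columns by π, i.e. the conjugate
  -- of A by a permutation matrix, has diagonal blocks of sizes k and n - k
  -- with 0 < k < n, and a zero block below them.
  IsReducible : ∀ {n} → Matrix Carrier n → Set
  IsReducible {n} A =
    ∃ λ (π : Permutation′ n) → ∃[ k ] 0 ℕ.< k × k ℕ.< n ×
      (∀ i j → k ℕ.≤ toℕ i → toℕ j ℕ.< k → A (π ⟨$⟩ʳ i) (π ⟨$⟩ʳ j) ≈ 0#)

  IsIrreducible : ∀ {n} → Matrix Carrier n → Set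
  IsIrreducible A = ¬ IsReducible A

  Realizable : List ℂ → Set
  Realizable σ = ∃[ A ] Nonnegative {length σ} A × HasEigenvalues A σ

  IrreduciblyRealizable : List ℂ → Set
  IrreduciblyRealizable σ =
    ∃[ A ] Nonnegative {length σ} A × IsIrreducible A × HasEigenvalues A σ

  -- σ is {a, b, -a} as a multiset, with a > b > 0.
  IsExceptional : List ℂ → Set
  IsExceptional σ = ∃[ a ] ∃[ b ]
    b < a × 0# < b × σ ↭ (fromℝ a ∷ fromℝ b ∷ fromℝ (- a) ∷ [])

{-# OPTIONS --safe #-}
module Submission where

-- Write E₁, E₂, E₃ for the coefficients of the characteristic polynomial of a
-- nonnegative realization A, and r = ρ(σ).  If the polynomial is negative at the
-- mean m = E₁/3, then σ is realized by m I plus a companion matrix, which is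
-- irreducible; its entry 3m² - E₂ is nonnegative by the Johnson–Loewy–London
-- inequality for A.  This covers every σ with a non-real element.  Otherwise
-- σ = {r, p, p′} with p ≥ m, p ≥ p′, and then a tridiagonal matrix with
-- superdiagonal 1, 1 works, unless r + p′ = 0 < p.
--
-- For {a, b, -a} the relations E₃ = E₁ E₂ and E₂ = -a² express zero as a sum of
-- nonnegative terms, which forces the products of entries along all cycles of
-- length 2 and 3 through the index with the largest diagonal entry to vanish.
-- Hence the digraph is not strongly connected.

open import Defs
open import Algebra.Bundles using (CommutativeRing)
import Algebra.Construct.NaturalChoice.Max as NaturalMax
import Algebra.Properties.AbelianGroup as AbelianGroupProperties
import Algebra.Properties.Ring as RingProperties
import Algebra.Properties.Semiring.Mult.TCOptimised as Mult
import Algebra.Solver.Ring as RingSolver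
open import Algebra.Solver.Ring.AlmostCommutativeRing
  using (_-Raw-AlmostCommutative⟶_; fromCommutativeRing)
open import Data.Fin.Base using (Fin; toℕ; fromℕ<)
open import Data.Fin.Patterns using (0F; 1F; 2F)
open import Data.Fin.Permutation
  using (Permutation′; _⟨$⟩ʳ_; _⟨$⟩ˡ_; _∘ₚ_; transpose; inverseˡ; inverseʳ)
import Data.Fin.Properties as Fin
open import Data.Integer.Base as ℤ using (ℤ; +_; -[1+_]; _⊖_; _◃_)
import Data.Integer.Properties as ℤ
open import Data.List.Base using (List; []; _∷_; length)
open import Data.List.Properties using (filter-accept; filter-reject)
import Data.List.Relation.Binary.Permutation.Setoid as PermutationSetoid
import Data.List.Relation.Binary.Permutation.Setoid.Properties as PermutationProperties
open import Data.List.Relation.Binary.Pointwise using ([]; _∷_)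
open import Data.List.Relation.Unary.All as All using (All; []; _∷_)
open import Data.Maybe.Base using (Maybe; map)
open import Data.Nat.Base as ℕ using (ℕ; z≤n; s≤s)
import Data.Nat.Properties as ℕ
open import Data.Product.Base using (_×_; _,_; ∃; proj₁; proj₂)
open import Data.Sign.Base as Sign using ()
open import Data.Sum.Base using (_⊎_; inj₁; inj₂; [_,_]′; map₂)
open import Function.Base using (_∘_)
open import Function.Bundles using (_⇔_; mk⇔)
open import Level using (0ℓ)
open import Relation.Binary.PropositionalEquality as ≡ using (_≡_; _≢_)
import Relation.Binary.Reasoning.Setoid as SetoidReasoning
open import Relation.Nullary using (¬_; yes; no; contradiction)
open import Relation.Nullary.Decidable using (dec⇒maybe)

-- A ring solver with integer coefficients for an arbitrary commutative ring.

module IntegerCoefficients (R : CommutativeRing 0ℓ 0ℓ) where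
  open CommutativeRing R
  open RingProperties ring
  open AbelianGroupProperties +-abelianGroup using (⁻¹-∙-comm; ε⁻¹≈ε)
  open Mult semiring using (×1-homo-*; ×-homo-+; 1+×) renaming (_×_ to _·_)
  open SetoidReasoning setoid

  ⟦_⟧ : ℤ → Carrier
  ⟦ + n      ⟧ = n · 1#
  ⟦ -[1+ n ] ⟧ = - (ℕ.suc n · 1#)

  ⟦-+⟧ : ∀ n → ⟦ ℤ.- (+ n) ⟧ ≈ - (n · 1#)
  ⟦-+⟧ ℕ.zero    = sym ε⁻¹≈ε
  ⟦-+⟧ (ℕ.suc n) = refl

  ⟦⊖⟧ : ∀ m n → ⟦ m ⊖ n ⟧ ≈ m · 1# - n · 1#
  ⟦⊖⟧ m ℕ.zero = begin
    m · 1#       ≈⟨ +-identityʳ _ ⟨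
    m · 1# + 0#  ≈⟨ +-congˡ ε⁻¹≈ε ⟨
    m · 1# - 0#  ∎
  ⟦⊖⟧ ℕ.zero (ℕ.suc n) = sym (+-identityˡ _)
  ⟦⊖⟧ (ℕ.suc m) (ℕ.suc n) = begin
    ⟦ ℕ.suc m ⊖ ℕ.suc n ⟧                 ≡⟨ ≡.cong ⟦_⟧ (ℤ.[1+m]⊖[1+n]≡m⊖n m n) ⟩
    ⟦ m ⊖ n ⟧                             ≈⟨ ⟦⊖⟧ m n ⟩
    m · 1# - n · 1#                       ≈⟨ +-congʳ (+-identityˡ _) ⟨
    -- Inserting 1 - 1 supplies the unit that turns m into m + 1 and n into n + 1.
    0# + m · 1# - n · 1#                  ≈⟨ +-congʳ (+-congʳ (-‿inverseʳ 1#)) ⟨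
    1# - 1# + m · 1# - n · 1#             ≈⟨ +-congʳ (+-assoc _ _ _) ⟩
    1# + (- 1# + m · 1#) - n · 1#         ≈⟨ +-congʳ (+-congˡ (+-comm _ _)) ⟩
    1# + (m · 1# - 1#) - n · 1#           ≈⟨ +-congʳ (+-assoc _ _ _) ⟨
    1# + m · 1# - 1# - n · 1#             ≈⟨ +-assoc _ _ _ ⟩
    1# + m · 1# + (- 1# - n · 1#)         ≈⟨ +-congˡ (⁻¹-∙-comm 1# (n · 1#)) ⟩
    1# + m · 1# - (1# + n · 1#)           ≈⟨ +-cong (1+× m 1#) (-‿cong (1+× n 1#)) ⟨
    ℕ.suc m · 1# - ℕ.suc n · 1#           ∎

  ⟦⟧-homo-+ : ∀ i j → ⟦ i ℤ.+ j ⟧ ≈ ⟦ i ⟧ + ⟦ j ⟧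
  ⟦⟧-homo-+ (+ m)      (+ n)      = ×-homo-+ 1# m n
  ⟦⟧-homo-+ (+ m)      -[1+ n ]   = ⟦⊖⟧ m (ℕ.suc n)
  ⟦⟧-homo-+ -[1+ m ]   (+ n)      = trans (⟦⊖⟧ n (ℕ.suc m)) (+-comm _ _)
  ⟦⟧-homo-+ -[1+ m ]   -[1+ n ]   = begin
    - (ℕ.suc (ℕ.suc (m ℕ.+ n)) · 1#)      ≈⟨ -‿cong (1+× (ℕ.suc (m ℕ.+ n)) 1#) ⟩
    - (1# + ℕ.suc (m ℕ.+ n) · 1#)         ≈⟨ -‿cong (+-congˡ (×-homo-+ 1# (ℕ.suc m) n)) ⟩
    - (1# + (ℕ.suc m · 1# + n · 1#))      ≈⟨ -‿cong (+-assoc _ _ _) ⟨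
    - (1# + ℕ.suc m · 1# + n · 1#)        ≈⟨ -‿cong (+-congʳ (+-comm _ _)) ⟩
    - (ℕ.suc m · 1# + 1# + n · 1#)        ≈⟨ -‿cong (+-assoc _ _ _) ⟩
    - (ℕ.suc m · 1# + (1# + n · 1#))      ≈⟨ -‿cong (+-congˡ (1+× n 1#)) ⟨
    - (ℕ.suc m · 1# + ℕ.suc n · 1#)       ≈⟨ ⁻¹-∙-comm _ _ ⟨
    - (ℕ.suc m · 1#) - ℕ.suc n · 1#       ∎

  ⟦-◃⟧ : ∀ n → ⟦ Sign.- ◃ n ⟧ ≈ - (n · 1#)
  ⟦-◃⟧ ℕ.zero    = sym ε⁻¹≈ε
  ⟦-◃⟧ (ℕ.suc n) = refl

  ⟦⟧-homo-* : ∀ i j → ⟦ i ℤ.* j ⟧ ≈ ⟦ i ⟧ * ⟦ j ⟧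
  ⟦⟧-homo-* (+ m) (+ n) = begin
    ⟦ Sign.+ ◃ (m ℕ.* n) ⟧  ≡⟨ ≡.cong ⟦_⟧ (ℤ.+◃n≡+n (m ℕ.* n)) ⟩
    (m ℕ.* n) · 1#          ≈⟨ ×1-homo-* m n ⟩
    m · 1# * n · 1#         ∎
  ⟦⟧-homo-* (+ m) -[1+ n ] = begin
    ⟦ Sign.- ◃ (m ℕ.* ℕ.suc n) ⟧  ≈⟨ ⟦-◃⟧ (m ℕ.* ℕ.suc n) ⟩
    - ((m ℕ.* ℕ.suc n) · 1#)      ≈⟨ -‿cong (×1-homo-* m (ℕ.suc n)) ⟩
    - (m · 1# * ℕ.suc n · 1#)     ≈⟨ -‿distribʳ-* _ _ ⟩
    m · 1# * - (ℕ.suc n · 1#)     ∎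
  ⟦⟧-homo-* -[1+ m ] (+ n) = begin
    ⟦ Sign.- ◃ (ℕ.suc m ℕ.* n) ⟧  ≈⟨ ⟦-◃⟧ (ℕ.suc m ℕ.* n) ⟩
    - ((ℕ.suc m ℕ.* n) · 1#)      ≈⟨ -‿cong (×1-homo-* (ℕ.suc m) n) ⟩
    - (ℕ.suc m · 1# * n · 1#)     ≈⟨ -‿distribˡ-* _ _ ⟩
    - (ℕ.suc m · 1#) * n · 1#     ∎
  ⟦⟧-homo-* -[1+ m ] -[1+ n ] = begin
    (ℕ.suc m ℕ.* ℕ.suc n) · 1#            ≈⟨ ×1-homo-* (ℕ.suc m) (ℕ.suc n) ⟩
    ℕ.suc m · 1# * ℕ.suc n · 1#           ≈⟨ -‿involutive _ ⟨
    - - (ℕ.suc m · 1# * ℕ.suc n · 1#)     ≈⟨ -‿cong (-‿distribʳ-* _ _) ⟩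
    - (ℕ.suc m · 1# * - (ℕ.suc n · 1#))   ≈⟨ -‿distribˡ-* _ _ ⟩
    - (ℕ.suc m · 1#) * - (ℕ.suc n · 1#)   ∎

  ⟦⟧-homo-neg : ∀ i → ⟦ ℤ.- i ⟧ ≈ - ⟦ i ⟧
  ⟦⟧-homo-neg (+ n)    = ⟦-+⟧ n
  ⟦⟧-homo-neg -[1+ n ] = sym (-‿involutive _)

  ℤ-morphism : ℤ.+-*-rawRing -Raw-AlmostCommutative⟶ fromCommutativeRing R
  ℤ-morphism = record
    { ⟦_⟧ = ⟦_⟧
    ; +-homo = ⟦⟧-homo-+
    ; *-homo = ⟦⟧-homo-*
    ; -‿homo = ⟦⟧-homo-neg
    ; 0-homo = refl
    ; 1-homo = refl
    }

  -- Coefficients are compared in ℤ, where equality is decidable. Distinct integers may still have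
  -- equal images, hence `Maybe`.
  coefficient≟ : ∀ i j → Maybe (⟦ i ⟧ ≈ ⟦ j ⟧)
  coefficient≟ i j = map (λ i≡j → reflexive (≡.cong ⟦_⟧ i≡j)) (dec⇒maybe (i ℤ.≟ j))

  open RingSolver ℤ.+-*-rawRing (fromCommutativeRing R) ℤ-morphism coefficient≟ public
    using (solve; Polynomial; con; _:+_; _:*_; _:-_; :-_; _:=_)

-- Equations modulo hypotheses.

module LinearCombination (R : CommutativeRing 0ℓ 0ℓ) where
  open CommutativeRing R
  open SetoidReasoning setoid

  -- The multiplier `c` is a certificate: it reduces a consequence of `l ≈ r` to a ring identity.
  -- Nested uses handle several hypotheses, and the solver proves the identity that remains.
  ≈-by : ∀ {x y l r} c → l ≈ r → x ≈ y + c * (l - r) → x ≈ y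
  ≈-by {x} {y} {l} {r} c l≈r x≈ = begin
    x                ≈⟨ x≈ ⟩
    y + c * (l - r)  ≈⟨ +-congˡ (*-congˡ (trans (+-congʳ l≈r) (-‿inverseʳ r))) ⟩
    y + c * 0#       ≈⟨ +-congˡ (zeroʳ c) ⟩
    y + 0#           ≈⟨ +-identityʳ y ⟩
    y                ∎

-- The characteristic polynomial of a 3 × 3 matrix.

module Cubic (R : CommutativeRing 0ℓ 0ℓ) where
  open CommutativeRing R
  open Determinant R
  open IntegerCoefficients R
  open LinearCombination R

  -- The trace, the sum of the principal 2 × 2 minors and the determinant.
  E₁ E₂ E₃ : Matrix Carrier 3 → Carrier
  E₁ A = A 0F 0F + A 1F 1F + A 2F 2F
  E₂ A = (A 0F 0F * A 1F 1F - A 0F 1F * A 1F 0F)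
       + (A 0F 0F * A 2F 2F - A 0F 2F * A 2F 0F)
       + (A 1F 1F * A 2F 2F - A 1F 2F * A 2F 1F)
  E₃ A = A 0F 0F * (A 1F 1F * A 2F 2F - A 1F 2F * A 2F 1F)
       - A 0F 1F * (A 1F 0F * A 2F 2F - A 1F 2F * A 2F 0F)
       + A 0F 2F * (A 1F 0F * A 2F 1F - A 1F 1F * A 2F 0F)

  cubic : Carrier → Carrier → Carrier → Carrier → Carrier
  cubic a b c z = z * z * z - a * (z * z) + b * z - c

  det₃ : ∀ M → det {3} M ≈ E₃ M
  det₃ M = solve 9 (λ a b c d e f g h i →
      -- The left side copies the unfolded Laplace expansion literally, with its powers of -1 and
      -- its trailing zeros, so that `refl` fits.
      let 0′ = con (+ 0); 1′ = con (+ 1); n = :- 1′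
          det₁ = λ x → 1′ :* (x :* 1′) :+ 0′
          det₂ = λ x y z w → 1′ :* (x :* det₁ w) :+ (n :* 1′ :* (y :* det₁ z) :+ 0′)
      in 1′ :* (a :* det₂ e f h i) :+ (n :* 1′ :* (b :* det₂ d f g i) :+ (n :* (n :* 1′) :* (c :* det₂ d e g h) :+ 0′))
      := a :* (e :* i :- f :* h) :- b :* (d :* i :- f :* g) :+ c :* (d :* h :- e :* g))
    refl (M 0F 0F) (M 0F 1F) (M 0F 2F) (M 1F 0F) (M 1F 1F) (M 1F 2F) (M 2F 0F) (M 2F 1F) (M 2F 2F)

  det-zI-A : ∀ A z → det {3} (λ i j → z * identityMatrix i j + - A i j)
                     ≈ cubic (E₁ A) (E₂ A) (E₃ A) z
  det-zI-A A z = trans (det₃ λ i j → z * identityMatrix i j + - A i j) (solve 10 (λ z a b c d e f g h i →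
      let 0′ = con (+ 0); 1′ = con (+ 1)
          D = λ x → z :* 1′ :+ :- x
          O = λ x → z :* 0′ :+ :- x
          det = λ a b c d e f g h i → a :* (e :* i :- f :* h) :- b :* (d :* i :- f :* g) :+ c :* (d :* h :- e :* g)
      in det (D a) (O b) (O c) (O d) (D e) (O f) (O g) (O h) (D i)
      := z :* z :* z :- (a :+ e :+ i) :* (z :* z)
         :+ ((a :* e :- b :* d) :+ (a :* i :- c :* g) :+ (e :* i :- f :* h)) :* z
         :- det a b c d e f g h i)
    refl z (A 0F 0F) (A 0F 1F) (A 0F 2F) (A 1F 0F) (A 1F 1F) (A 1F 2F) (A 2F 0F) (A 2F 1F) (A 2F 2F))

  cubic-roots : ∀ x y w z → (z - x) * ((z - y) * ((z - w) * 1#))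
                          ≈ cubic (x + y + w) (x * y + x * w + y * w) (x * y * w) z
  cubic-roots = solve 4 (λ x y w z →
      (z :- x) :* ((z :- y) :* ((z :- w) :* con (+ 1)))
      := z :* z :* z :- (x :+ y :+ w) :* (z :* z) :+ (x :* y :+ x :* w :+ y :* w) :* z :- x :* y :* w)
    refl

  cubic-cong : ∀ {a b c a′ b′ c′} → a ≈ a′ → b ≈ b′ → c ≈ c′ → ∀ z → cubic a b c z ≈ cubic a′ b′ c′ z
  cubic-cong a≈a′ b≈b′ c≈c′ z =
    +-cong (+-cong (+-congˡ (-‿cong (*-congʳ a≈a′))) (*-congʳ b≈b′)) (-‿cong c≈c′)

  -- The value at 0 gives c. The values at 1 and -1 add up to -2a - 2c, which gives a because 2 is
  -- invertible. The value at 1 then gives b.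
  cubic-injective : ∀ {a b c a′ b′ c′} h → (1# + 1#) * h ≈ 1# →
    (∀ z → cubic a b c z ≈ cubic a′ b′ c′ z) → a ≈ a′ × b ≈ b′ × c ≈ c′
  cubic-injective {a} {b} {c} {a′} {b′} {c′} h 2h≈1 eq = a≈a′ , b≈b′ , c≈c′
    where
    0′ 1′ : ∀ {n} → Polynomial n
    0′ = con (+ 0)
    1′ = con (+ 1)
    P : ∀ {n} → Polynomial n → Polynomial n → Polynomial n → Polynomial n → Polynomial n
    P a b c z = z :* z :* z :- a :* (z :* z) :+ b :* z :- c
    c≈c′ : c ≈ c′
    c≈c′ = ≈-by (- 1#) (eq 0#) (solve 6 (λ a b c a′ b′ c′ →
      c := c′ :+ :- 1′ :* (P a b c 0′ :- P a′ b′ c′ 0′)) refl a b c a′ b′ c′)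
    a≈a′ : a ≈ a′
    a≈a′ = ≈-by (a′ - a) 2h≈1 (≈-by (- h) (eq 1#) (≈-by (- h) (eq (- 1#)) (≈-by (- (h + h)) c≈c′
      (solve 7 (λ a b c a′ b′ c′ h →
        a := a′ :+ (a′ :- a) :* ((1′ :+ 1′) :* h :- 1′)
             :+ :- h :* (P a b c 1′ :- P a′ b′ c′ 1′)
             :+ :- h :* (P a b c (:- 1′) :- P a′ b′ c′ (:- 1′))
             :+ :- (h :+ h) :* (c :- c′)) refl a b c a′ b′ c′ h))))
    b≈b′ : b ≈ b′
    b≈b′ = ≈-by 1# a≈a′ (≈-by 1# c≈c′ (≈-by 1# (eq 1#)
      (solve 6 (λ a b c a′ b′ c′ →
        b := b′ :+ 1′ :* (a :- a′) :+ 1′ :* (c :- c′)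
             :+ 1′ :* (P a b c 1′ :- P a′ b′ c′ 1′)) refl a b c a′ b′ c′)))

-- Strict inequalities, reciprocals and small positive numbers.

module Order (ℝ : CompleteOrderedField) where
  open CompleteOrderedField ℝ
  open SquareRoot ℝ

  ≰⇒> : ∀ {x y} → ¬ x ≤ y → y < x
  ≰⇒> {x} {y} x≰y with total x y
  ... | inj₁ x≤y = contradiction x≤y x≰y
  ... | inj₂ y≤x = y≤x , λ y≈x → x≰y (≤-reflexive (sym y≈x))

  0<⇒≉0 : ∀ {x} → 0# < x → ¬ x ≈ 0#
  0<⇒≉0 (_ , 0≉x) x≈0 = 0≉x (sym x≈0)

  0<-resp : ∀ {x y} → x ≈ y → 0# < x → 0# < y
  0<-resp x≈y (0≤x , 0≉x) = ≤-respʳ x≈y 0≤x , λ 0≈y → 0≉x (trans 0≈y (sym x≈y))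

  +-positive : ∀ {x y} → 0# < x → 0# ≤ y → 0# < x + y
  +-positive (0≤x , 0≉x) 0≤y =
    +-nonNegative 0≤x 0≤y , λ 0≈x+y → 0≉x (sym (+-zero⇒zero 0≤x 0≤y (sym 0≈x+y)))

  *-positive : ∀ {x y} → 0# < x → 0# < y → 0# < x * y
  *-positive 0<x (0≤y , 0≉y) =
    *-nonNegative (proj₁ 0<x) 0≤y , λ 0≈xy → 0≉y (sym (*-zero⇒zero (0<⇒≉0 0<x) (sym 0≈xy)))

  x<y⇒0<y-x : ∀ {x y} → x < y → 0# < y - x
  x<y⇒0<y-x {x} {y} (x≤y , x≉y) = x≤y⇒0≤y-x x≤y , λ 0≈y-x → x≉y
    (trans (sym (+-identityʳ x)) (trans (+-congˡ 0≈y-x) (x+[y-x]≈y x y)))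

  0<1 : 0# < 1#
  0<1 = 0≤1 , 0≉1

  reciprocal : ∀ {x} → 0# < x → ∃ λ g → 0# < g × x * g ≈ 1#
  reciprocal {x} 0<x with inverse x (0<⇒≉0 0<x)
  ... | g , xg≈1 = g , (inverse-nonNegative (proj₁ 0<x) xg≈1 , λ 0≈g →
          0≉1 (trans (sym (zeroʳ x)) (trans (*-congˡ 0≈g) xg≈1))) , xg≈1

  half : ∃ λ h → 0# < h × (1# + 1#) * h ≈ 1#
  half = reciprocal (+-positive 0<1 0≤1)

  x*y≈0⇒x≈0⊎y≈0 : ∀ {x y} → x * y ≈ 0# → x ≈ 0# ⊎ y ≈ 0#
  x*y≈0⇒x≈0⊎y≈0 {x} xy≈0 with x ≟ 0#
  ... | yes x≈0 = inj₁ x≈0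
  ... | no  x≉0 = inj₂ (*-zero⇒zero x≉0 xy≈0)

  private
    module S = IntegerCoefficients commutativeRing
  open S using (_:+_; _:*_; _:-_; _:=_; con)
  open LinearCombination commutativeRing

  lower-bound : ∀ {x} → 0# < x → ∃ λ ε → 0# < ε × 0# < x - ε
  lower-bound {x} 0<x with half
  ... | h , 0<h , 2h≈1 = h * x , 0<hx , 0<-resp (≈-by x 2h≈1 hx≈x-hx) 0<hx
    where
    0<hx : 0# < h * x
    0<hx = *-positive 0<h 0<x
    hx≈x-hx : h * x ≈ x - h * x + x * ((1# + 1#) * h - 1#)
    hx≈x-hx = S.solve 2 (λ x h →
      h :* x := x :- h :* x :+ x :* ((con (+ 1) :+ con (+ 1)) :* h :- con (+ 1))) refl x h

  detour : ∀ x y ε → (x - ε) + (y - x) ≈ y - ε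
  detour = S.solve 3 (λ x y ε → (x :- ε) :+ (y :- x) := y :- ε) refl

  -- Half of the smaller number lies strictly below both.
  common-lower-bound : ∀ {x y} → 0# < x → 0# < y →
    ∃ λ ε → 0# < ε × 0# < x - ε × 0# < y - ε
  common-lower-bound {x} {y} 0<x 0<y with total x y
  ... | inj₁ x≤y = let (ε , 0<ε , 0<x-ε) = lower-bound 0<x in
    ε , 0<ε , 0<x-ε , 0<-resp (detour x y ε) (+-positive 0<x-ε (x≤y⇒0≤y-x x≤y))
  ... | inj₂ y≤x = let (ε , 0<ε , 0<y-ε) = lower-bound 0<y in
    ε , 0<ε , 0<-resp (detour y x ε) (+-positive 0<y-ε (x≤y⇒0≤y-x y≤x)) , 0<y-ε

-- Reducibility in terms of the digraph, and a family of irreducible matrices.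

module Reducibility (ℝ : CompleteOrderedField) where
  open CompleteOrderedField ℝ
  open Spectra ℝ

  -- The set F is the first diagonal block: no edge of the digraph enters it.
  reducible⇒closed : ∀ {n} (A : Matrix Carrier n) → IsReducible A →
    ∃ λ (F : Fin n → Set) → ∃ F × ∃ (¬_ ∘ F) × (∀ i j → ¬ A i j ≈ 0# → F j → F i)
  reducible⇒closed {n} A (π , k , 0<k , k<n , zero-block) =
    F , (π ⟨$⟩ʳ first , ≡.subst (ℕ._< k) (≡.sym toℕ-first) 0<k)
      , (π ⟨$⟩ʳ fromℕ< k<n , ℕ.<-irrefl toℕ-last)
      , closed
    where
    F : Fin n → Set
    F i = toℕ (π ⟨$⟩ˡ i) ℕ.< k
    first = fromℕ< (ℕ.<-trans 0<k k<n)
    toℕ-first : toℕ (π ⟨$⟩ˡ (π ⟨$⟩ʳ first)) ≡ 0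
    toℕ-first = ≡.trans (≡.cong toℕ (inverseˡ π)) (Fin.toℕ-fromℕ< _)
    toℕ-last : toℕ (π ⟨$⟩ˡ (π ⟨$⟩ʳ fromℕ< k<n)) ≡ k
    toℕ-last = ≡.trans (≡.cong toℕ (inverseˡ π)) (Fin.toℕ-fromℕ< k<n)
    closed : ∀ i j → ¬ A i j ≈ 0# → F j → F i
    closed i j Aij≉0 j∈F with toℕ (π ⟨$⟩ˡ i) ℕ.<? k
    ... | yes i∈F = i∈F
    ... | no  i∉F = contradiction
      (≡.subst₂ (λ i j → A i j ≈ 0#) (inverseʳ π) (inverseʳ π)
        (zero-block _ _ (ℕ.≮⇒≥ i∉F) j∈F))
      Aij≉0

  -- A transposition moves `i` to the last place, where its row supplies the 1 × 2 zero block.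
  noExit⇒reducible : ∀ (A : Matrix Carrier 3) i → (∀ j → j ≢ i → A i j ≈ 0#) → IsReducible A
  noExit⇒reducible A i noExit = transpose i 2F , 2 , s≤s z≤n , s≤s (s≤s (s≤s z≤n)) , block i noExit
    where
    block : ∀ i → (∀ j → j ≢ i → A i j ≈ 0#) → ∀ k l → 2 ℕ.≤ toℕ k → toℕ l ℕ.< 2 →
      A (transpose i 2F ⟨$⟩ʳ k) (transpose i 2F ⟨$⟩ʳ l) ≈ 0#
    block 0F zeros 2F 0F _ _ = zeros 2F λ ()
    block 0F zeros 2F 1F _ _ = zeros 1F λ ()
    block 1F zeros 2F 0F _ _ = zeros 0F λ ()
    block 1F zeros 2F 1F _ _ = zeros 2F λ ()
    block 2F zeros 2F 0F _ _ = zeros 0F λ ()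
    block 2F zeros 2F 1F _ _ = zeros 1F λ ()
    block _  _     0F _  () _
    block _  _     1F _  (s≤s ()) _
    block _  _     _  2F _ (s≤s (s≤s ()))

  -- A transposition moves `i` to the first place, where its column supplies the 2 × 1 zero block.
  noEntry⇒reducible : ∀ (A : Matrix Carrier 3) i → (∀ j → j ≢ i → A j i ≈ 0#) → IsReducible A
  noEntry⇒reducible A i noEntry = transpose i 0F , 1 , s≤s z≤n , s≤s (s≤s z≤n) , block i noEntry
    where
    block : ∀ i → (∀ j → j ≢ i → A j i ≈ 0#) → ∀ k l → 1 ℕ.≤ toℕ k → toℕ l ℕ.< 1 →
      A (transpose i 0F ⟨$⟩ʳ k) (transpose i 0F ⟨$⟩ʳ l) ≈ 0#
    block 0F zeros 1F 0F _ _ = zeros 1F λ ()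
    block 0F zeros 2F 0F _ _ = zeros 2F λ ()
    block 1F zeros 1F 0F _ _ = zeros 0F λ ()
    block 1F zeros 2F 0F _ _ = zeros 2F λ ()
    block 2F zeros 1F 0F _ _ = zeros 1F λ ()
    block 2F zeros 2F 0F _ _ = zeros 0F λ ()
    block _  _     0F _  () _
    block _  _     _  1F _ (s≤s ())
    block _  _     _  2F _ (s≤s ())

  -- Besides the loops, the only cycles are 0 → 1 → 0, 1 → 2 → 1 and 0 → 1 → 2 → 0, with weights
  -- `t`, `v` and `u`. So `E₂` and `E₃` are affine in `t`, `u`, `v`, which can be solved for once
  -- the diagonal is chosen.
  family : (a b c t u v : Carrier) → Matrix Carrier 3
  family a b c t u v 0F 0F = a
  family a b c t u v 0F 1F = 1#
  family a b c t u v 0F 2F = 0#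
  family a b c t u v 1F 0F = t
  family a b c t u v 1F 1F = b
  family a b c t u v 1F 2F = 1#
  family a b c t u v 2F 0F = u
  family a b c t u v 2F 1F = v
  family a b c t u v 2F 2F = c

  module _ {a b c t u v : Carrier} where
    open SquareRoot ℝ using (0≤1)
    open Order ℝ using (0<⇒≉0; 0<1)

    -- Membership in a closed set travels against the edges: from 2 through 1 to 0 along the
    -- superdiagonal, and from 0 back to 2 either directly by `u` or through 1 by `t` and `v`. So a
    -- nonempty closed set contains every index.
    family-irreducible : 0# < u ⊎ (0# < t × 0# < v) → IsIrreducible (family a b c t u v)
    family-irreducible pos reducible with reducible⇒closed (family a b c t u v) reducible
    ... | F , (i , i∈F) , (j , j∉F) , closed = j∉F (spread pos i i∈F j)
      where
      1→0 : F 1F → F 0F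
      1→0 = closed 0F 1F (0<⇒≉0 0<1)
      2→1 : F 2F → F 1F
      2→1 = closed 1F 2F (0<⇒≉0 0<1)
      all : F 2F → ∀ j → F j
      all F2 0F = 1→0 (2→1 F2)
      all F2 1F = 2→1 F2
      all F2 2F = F2
      spread : 0# < u ⊎ (0# < t × 0# < v) → ∀ i → F i → ∀ j → F j
      spread (inj₁ 0<u) = λ where
          0F F0 → all (0→2 F0)
          1F F1 → all (0→2 (1→0 F1))
          2F F2 → all F2
        where
        0→2 : F 0F → F 2F
        0→2 = closed 2F 0F (0<⇒≉0 0<u)
      spread (inj₂ (0<t , 0<v)) = λ where
          0F F0 → all (1→2 (0→1 F0))
          1F F1 → all (1→2 F1)
          2F F2 → all F2
        where
        0→1 : F 0F → F 1F
        0→1 = closed 1F 0F (0<⇒≉0 0<t)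
        1→2 : F 1F → F 2F
        1→2 = closed 2F 1F (0<⇒≉0 0<v)

    family-nonnegative : 0# ≤ a → 0# ≤ b → 0# ≤ c → 0# ≤ t → 0# ≤ u → 0# ≤ v →
      Nonnegative (family a b c t u v)
    family-nonnegative 0≤a 0≤b 0≤c 0≤t 0≤u 0≤v = λ where
      0F 0F → 0≤a
      0F 1F → 0≤1
      0F 2F → ≤-refl
      1F 0F → 0≤t
      1F 1F → 0≤b
      1F 2F → 0≤1
      2F 0F → 0≤u
      2F 1F → 0≤v
      2F 2F → 0≤c

-- Eigenvalue lists and Vieta's formulas over ℂ.

module ComplexPolynomials (ℝ : CompleteOrderedField) where
  open CompleteOrderedField ℝ
  open Spectra ℝ
  open IntegerCoefficients commutativeRing
  open LinearCombination commutativeRing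
  open Cubic commutativeRing
  private
    module ℂR = CommutativeRing ℂ-commutativeRing
    module Cℂ = Cubic ℂ-commutativeRing
    module ℂ↭ = PermutationProperties ℂR.setoid

  HasEigenvalues-resp-↭ : ∀ {n} (A : Matrix Carrier n) σ τ → σ ↭ τ →
    HasEigenvalues A σ → HasEigenvalues A τ
  HasEigenvalues-resp-↭ A σ τ σ↭τ eig z = ℂR.trans (eig z)
    (ℂ↭.foldr-commMonoid ℂR.*-isCommutativeMonoid
      (ℂ↭.map⁺ ℂR.setoid (λ μ≈ν → ℂR.+-congˡ (ℂR.-‿cong μ≈ν)) σ↭τ))

  sumℂ-resp-↭ : ∀ {σ τ} → σ ↭ τ → sumℂ σ ≈ℂ sumℂ τ
  sumℂ-resp-↭ = ℂ↭.foldr-commMonoid ℂR.+-isCommutativeMonoid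

  complexify : ∀ {n} → Matrix Carrier n → Matrix ℂ n
  complexify A i j = fromℝ (A i j)

  -- Pairs of polynomials stand for complex polynomials, so that the real ring
  -- solver can treat real and imaginary parts.
  private
    infixl 7 _⊕_
    infixl 8 _⊗_
    _⊕_ _⊗_ : ∀ {n} → Polynomial n × Polynomial n → Polynomial n × Polynomial n → Polynomial n × Polynomial n
    (a , b) ⊕ (c , d) = a :+ c , b :+ d
    (a , b) ⊗ (c , d) = a :* c :- b :* d , a :* d :+ b :* c

    ⊖_ : ∀ {n} → Polynomial n × Polynomial n → Polynomial n × Polynomial n
    ⊖ (a , b) = :- a , :- b

    real : ∀ {n} → Polynomial n → Polynomial n × Polynomial n
    real a = a , con (+ 0)

  private
    -- `fromℝ` is a ring homomorphism. Operating on equations lets a proof have the shape of the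
    -- formula it transports.
    _⊞_ : ∀ {a b x y} → fromℝ a ≈ℂ x → fromℝ b ≈ℂ y → fromℝ (a + b) ≈ℂ x +ℂ y
    a≈x ⊞ b≈y = ℂR.trans (refl , sym (+-identityˡ 0#)) (ℂR.+-cong a≈x b≈y)

    _⊠_ : ∀ {a b x y} → fromℝ a ≈ℂ x → fromℝ b ≈ℂ y → fromℝ (a * b) ≈ℂ x *ℂ y
    _⊠_ {a} {b} a≈x b≈y = ℂR.trans
      ( solve 2 (λ a b → a :* b := proj₁ (real a ⊗ real b)) refl a b
      , solve 2 (λ a b → con (+ 0) := proj₂ (real a ⊗ real b)) refl a b )
      (ℂR.*-cong a≈x b≈y)

    ⊟_ : ∀ {a x} → fromℝ a ≈ℂ x → fromℝ (- a) ≈ℂ -ℂ x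
    ⊟ a≈x = ℂR.trans (refl , sym (RingProperties.-0#≈0# ring)) (ℂR.-‿cong a≈x)

    minor : ∀ (a b c d : Carrier) → fromℝ (a * d - b * c) ≈ℂ fromℝ a *ℂ fromℝ d +ℂ -ℂ (fromℝ b *ℂ fromℝ c)
    minor a b c d = (entry a ⊠ entry d) ⊞ (⊟ (entry b ⊠ entry c))
      where
      entry : ∀ a → fromℝ a ≈ℂ fromℝ a
      entry a = ℂR.refl

  fromℝ-E₁ : ∀ A → fromℝ (E₁ A) ≈ℂ Cℂ.E₁ (complexify A)
  fromℝ-E₁ A = (ℂR.refl {fromℝ (A 0F 0F)} ⊞ ℂR.refl {fromℝ (A 1F 1F)}) ⊞ ℂR.refl {fromℝ (A 2F 2F)}

  fromℝ-E₂ : ∀ A → fromℝ (E₂ A) ≈ℂ Cℂ.E₂ (complexify A)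
  fromℝ-E₂ A =
    (minor (A 0F 0F) (A 0F 1F) (A 1F 0F) (A 1F 1F)
      ⊞ minor (A 0F 0F) (A 0F 2F) (A 2F 0F) (A 2F 2F))
      ⊞ minor (A 1F 1F) (A 1F 2F) (A 2F 1F) (A 2F 2F)

  fromℝ-E₃ : ∀ A → fromℝ (E₃ A) ≈ℂ Cℂ.E₃ (complexify A)
  fromℝ-E₃ A =
    ((ℂR.refl {fromℝ (A 0F 0F)} ⊠ minor (A 1F 1F) (A 1F 2F) (A 2F 1F) (A 2F 2F))
      ⊞ (⊟ (ℂR.refl {fromℝ (A 0F 1F)} ⊠ minor (A 1F 0F) (A 1F 2F) (A 2F 0F) (A 2F 2F))))
      ⊞ (ℂR.refl {fromℝ (A 0F 2F)} ⊠ minor (A 1F 0F) (A 1F 1F) (A 2F 0F) (A 2F 1F))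

  characteristicPolynomial-cubic : ∀ A z → characteristicPolynomial A z
    ≈ℂ Cℂ.cubic (fromℝ (E₁ A)) (fromℝ (E₂ A)) (fromℝ (E₃ A)) z
  characteristicPolynomial-cubic A z = ℂR.trans (Cℂ.det-zI-A (complexify A) z)
    (ℂR.sym (Cℂ.cubic-cong (fromℝ-E₁ A) (fromℝ-E₂ A) (fromℝ-E₃ A) z))

  HasSameE : Matrix Carrier 3 → Matrix Carrier 3 → Set
  HasSameE A B = E₁ A ≈ E₁ B × E₂ A ≈ E₂ B × E₃ A ≈ E₃ B

  -- `E₁`, `E₂`, `E₃` determine the characteristic polynomial, so a realization can be replaced
  -- without finding eigenvalues again.
  HasEigenvalues-transfer : ∀ A B σ → HasSameE A B → HasEigenvalues A σ → HasEigenvalues B σ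
  HasEigenvalues-transfer A B σ (E₁≈ , E₂≈ , E₃≈) eig z =
    ℂR.trans (characteristicPolynomial-cubic B z)
    (ℂR.trans (ℂR.sym (Cℂ.cubic-cong (E₁≈ , refl) (E₂≈ , refl) (E₃≈ , refl) z))
    (ℂR.trans (ℂR.sym (characteristicPolynomial-cubic A z)) (eig z)))

  vieta : ∀ A x y w → HasEigenvalues A (x ∷ y ∷ w ∷ []) →
    fromℝ (E₁ A) ≈ℂ x ℂR.+ y ℂR.+ w ×
    fromℝ (E₂ A) ≈ℂ x ℂR.* y ℂR.+ x ℂR.* w ℂR.+ y ℂR.* w ×
    fromℝ (E₃ A) ≈ℂ x ℂR.* y ℂR.* w
  vieta A x y w eig = Cℂ.cubic-injective (fromℝ h) 2h≈1 λ z →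
    ℂR.trans (ℂR.sym (characteristicPolynomial-cubic A z))
    (ℂR.trans (eig z) (Cℂ.cubic-roots x y w z))
    where
    h = proj₁ (Order.half ℝ)
    2h≈1 : (ℂR.1# ℂR.+ ℂR.1#) ℂR.* fromℝ h ≈ℂ ℂR.1#
    2h≈1 =
      ≈-by 1# (proj₂ (proj₂ (Order.half ℝ))) (solve 1 (λ h → let 1′ = con (+ 1) in
        proj₁ ((real 1′ ⊕ real 1′) ⊗ real h) := 1′ :+ 1′ :* ((1′ :+ 1′) :* h :- 1′)) refl h)
      , solve 1 (λ h → proj₂ ((real (con (+ 1)) ⊕ real (con (+ 1))) ⊗ real h) := con (+ 0)) refl h

  -- The real parts give the coefficients. The imaginary part of `E₁` vanishes, so q′ = -q, and then
  -- that of `E₂` gives q (p - p′) = 0: the last two roots are real or conjugate.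
  vieta-parts : ∀ A r p q p′ q′ → HasEigenvalues A (fromℝ r ∷ (p +i q) ∷ (p′ +i q′) ∷ []) →
    (E₁ A ≈ r + p + p′ × E₂ A ≈ r * (p + p′) + p * p′ - q * q′ × E₃ A ≈ r * (p * p′ - q * q′)) ×
    q + q′ ≈ 0# × q * (p - p′) ≈ 0#
  vieta-parts A r p q p′ q′ eig =
    ( proj₁ (proj₁ coefficients)
    , trans (proj₁ (proj₁ (proj₂ coefficients))) E₂-re
    , trans (proj₁ (proj₂ (proj₂ coefficients))) E₃-re )
    , q+q′≈0
    , ≈-by (r + p) q+q′≈0 (≈-by 1# (proj₂ (proj₁ (proj₂ coefficients))) E₂-im)
    where
    coefficients = vieta A (fromℝ r) (p +i q) (p′ +i q′) eig
    0′ 1′ : ∀ {n} → Polynomial n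
    0′ = con (+ 0)
    1′ = con (+ 1)
    q+q′≈0 : q + q′ ≈ 0#
    q+q′≈0 = sym (trans (proj₂ (proj₁ coefficients)) (+-congʳ (+-identityˡ q)))
    E₂-re = solve 5 (λ r p q p′ q′ →
      proj₁ (real r ⊗ (p , q) ⊕ real r ⊗ (p′ , q′) ⊕ (p , q) ⊗ (p′ , q′))
      := r :* (p :+ p′) :+ p :* p′ :- q :* q′) refl r p q p′ q′
    E₂-im = solve 5 (λ r p q p′ q′ →
      q :* (p :- p′) := 0′ :+ (r :+ p) :* (q :+ q′ :- 0′)
        :+ 1′ :* (0′ :- proj₂ (real r ⊗ (p , q) ⊕ real r ⊗ (p′ , q′) ⊕ (p , q) ⊗ (p′ , q′))))
      refl r p q p′ q′
    E₃-re = solve 5 (λ r p q p′ q′ →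
      proj₁ (real r ⊗ (p , q) ⊗ (p′ , q′)) := r :* (p :* p′ :- q :* q′)) refl r p q p′ q′

-- Construction of irreducible realizations.

module Realization (ℝ : CompleteOrderedField) where
  open CompleteOrderedField ℝ
  open Spectra ℝ
  open SquareRoot ℝ using (+-nonNegative; 0≤x*x; x≤y⇒0≤y-x)
  open Order ℝ
  open Reducibility ℝ
  open IntegerCoefficients commutativeRing
  open LinearCombination commutativeRing
  open Cubic commutativeRing
  open ComplexPolynomials ℝ using (HasSameE)

  private
    0′ 1′ : ∀ {n} → Polynomial n
    0′ = con (+ 0)
    1′ = con (+ 1)

  third : ∃ λ g → 0# < g × (1# + 1# + 1#) * g ≈ 1#
  third = reciprocal (+-positive (+-positive 0<1 (proj₁ 0<1)) (proj₁ 0<1))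

  third*triple : ∀ x → proj₁ third * (x + x + x) ≈ x
  third*triple x = let (g , _ , 3g≈1) = third in ≈-by x 3g≈1
    (solve 2 (λ x g → g :* (x :+ x :+ x) := x :+ x :* ((1′ :+ 1′ :+ 1′) :* g :- 1′)) refl x g)

  triple-reflects-0≤ : ∀ {x} → 0# ≤ x + x + x → 0# ≤ x
  triple-reflects-0≤ {x} 0≤3x = ≤-respʳ (third*triple x)
    (*-nonNegative (proj₁ (proj₁ (proj₂ third))) 0≤3x)

  triple-reflects-0< : ∀ {x} → 0# < x + x + x → 0# < x
  triple-reflects-0< {x} 0<3x = 0<-resp (third*triple x) (*-positive (proj₁ (proj₂ third)) 0<3x)

  IrreducibleTwin : Matrix Carrier 3 → Set
  IrreducibleTwin A = ∃ λ B → Nonnegative B × IsIrreducible B × HasSameE A B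

  E₁-nonnegative : ∀ A → Nonnegative A → 0# ≤ E₁ A
  E₁-nonnegative A A≥0 = +-nonNegative (+-nonNegative (A≥0 0F 0F) (A≥0 1F 1F)) (A≥0 2F 2F)

  -- The Johnson–Loewy–London inequality (tr A)² ≤ 3 tr A², as tr A² = E₁² − 2 E₂.
  johnson-loewy-london : ∀ A → Nonnegative A → 0# ≤ E₁ A * E₁ A - (E₂ A + E₂ A + E₂ A)
  -- E₁² - 3 E₂ is half the sum of the squared differences of diagonal entries plus three times the
  -- sum of the weights of the 2-cycles.
  johnson-loewy-london A A≥0 = ≤-respʳ
    (≈-by (a * a + e * e + i * i - a * e - a * i - e * i) 2h≈1
      (solve 10 (λ h a b c d e f g j i →
        let E1 = a :+ e :+ i
            E2 = (a :* e :- b :* d) :+ (a :* i :- c :* g) :+ (e :* i :- f :* j)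
            s  = b :* d :+ c :* g :+ f :* j
            sq = λ x → x :* x
        in h :* (sq (a :- e) :+ sq (a :- i) :+ sq (e :- i)) :+ (s :+ s :+ s)
           := E1 :* E1 :- (E2 :+ E2 :+ E2)
              :+ (a :* a :+ e :* e :+ i :* i :- a :* e :- a :* i :- e :* i) :* ((1′ :+ 1′) :* h :- 1′))
        refl h a b c d e f g j i))
    (+-nonNegative
      (*-nonNegative (proj₁ 0<h)
        (+-nonNegative (+-nonNegative (0≤x*x (a - e)) (0≤x*x (a - i))) (0≤x*x (e - i))))
      (+-nonNegative (+-nonNegative 0≤s 0≤s) 0≤s))
    where
    h = proj₁ half
    0<h = proj₁ (proj₂ half)
    2h≈1 = proj₂ (proj₂ half)
    a = A 0F 0F
    b = A 0F 1F
    c = A 0F 2F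
    d = A 1F 0F
    e = A 1F 1F
    f = A 1F 2F
    g = A 2F 0F
    j = A 2F 1F
    i = A 2F 2F
    0≤s : 0# ≤ b * d + c * g + f * j
    0≤s = +-nonNegative (+-nonNegative (*-nonNegative (A≥0 0F 1F) (A≥0 1F 0F))
      (*-nonNegative (A≥0 0F 2F) (A≥0 2F 0F))) (*-nonNegative (A≥0 1F 2F) (A≥0 2F 1F))

  E₂-family : ∀ a b c t u v → E₂ (family a b c t u v) ≈ a * b + a * c + b * c - t - v
  E₂-family = solve 6 (λ a b c t u v →
    (a :* b :- 1′ :* t) :+ (a :* c :- 0′ :* u) :+ (b :* c :- 1′ :* v)
    := a :* b :+ a :* c :+ b :* c :- t :- v) refl

  E₃-family : ∀ a b c t u v → E₃ (family a b c t u v) ≈ a * b * c - a * v - c * t + u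
  E₃-family = solve 6 (λ a b c t u v →
    a :* (b :* c :- 1′ :* v) :- 1′ :* (t :* c :- 1′ :* u) :+ 0′ :* (t :* v :- b :* u)
    := a :* b :* c :- a :* v :- c :* t :+ u) refl

  mean : ∀ A → Nonnegative A → ∃ λ m → 0# ≤ m × m + m + m ≈ E₁ A
  mean A A≥0 = let (g , 0<g , 3g≈1) = third in
    g * E₁ A , *-nonNegative (proj₁ 0<g) (E₁-nonnegative A A≥0) ,
    ≈-by (E₁ A) 3g≈1 (solve 2 (λ g e → g :* e :+ g :* e :+ g :* e
      := e :+ e :* ((1′ :+ 1′ :+ 1′) :* g :- 1′)) refl g (E₁ A))

  -- With diagonal m, m, m and t = 0, matching `E₂` forces v = 3m² - E₂, and matching `E₃` forces u
  -- to be minus the value of the cubic at m.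
  negative-at-mean⇒twin : ∀ A → Nonnegative A → ∀ m → 0# ≤ m → m + m + m ≈ E₁ A →
    0# < - cubic (E₁ A) (E₂ A) (E₃ A) m → IrreducibleTwin A
  negative-at-mean⇒twin A A≥0 m 0≤m 3m≈E₁ 0<u =
    family m m m 0# u v ,
    family-nonnegative 0≤m 0≤m 0≤m ≤-refl (proj₁ 0<u) 0≤v ,
    family-irreducible (inj₁ 0<u) ,
    ( sym 3m≈E₁
    , sym (trans (E₂-family m m m 0# u v) (solve 2 (λ m e →
        m :* m :+ m :* m :+ m :* m :- 0′ :- (m :* m :+ m :* m :+ m :* m :- e) := e) refl m (E₂ A)))
    , sym (trans (E₃-family m m m 0# u v) (≈-by (- (m * m)) 3m≈E₁ (solve 4 (λ m a b c →
        m :* m :* m :- m :* (m :* m :+ m :* m :+ m :* m :- b) :- m :* 0′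
          :- (m :* m :* m :- a :* (m :* m) :+ b :* m :- c)
        := c :+ :- (m :* m) :* (m :+ m :+ m :- a)) refl m (E₁ A) (E₂ A) (E₃ A))))
    )
    where
    u = - cubic (E₁ A) (E₂ A) (E₃ A) m
    v = m * m + m * m + m * m - E₂ A
    0≤v : 0# ≤ v
    -- Since E₁ = 3m, 3v equals E₁² - 3 E₂.
    0≤v = triple-reflects-0≤ (≤-respʳ
      (≈-by (- (E₁ A + (m + m + m))) 3m≈E₁ (solve 3 (λ m a b →
        let v = m :* m :+ m :* m :+ m :* m :- b in
        a :* a :- (b :+ b :+ b)
        := v :+ v :+ v :+ :- (a :+ (m :+ m :+ m)) :* (m :+ m :+ m :- a)) refl m (E₁ A) (E₂ A)))
      (johnson-loewy-london A A≥0))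

  -- With s = q q′ these are the elementary symmetric functions of r, p + q i and
  -- p′ + q′ i, when those of the last two are real.
  HasRoots : Matrix Carrier 3 → (r p p′ s : Carrier) → Set
  HasRoots A r p p′ s =
    E₁ A ≈ r + p + p′ × E₂ A ≈ r * (p + p′) + p * p′ - s × E₃ A ≈ r * (p * p′ - s)

  HasRoots-swap : ∀ A {r p p′ s} → HasRoots A r p p′ s → HasRoots A r p′ p s
  HasRoots-swap A {r} {p} {p′} {s} (E₁≈ , E₂≈ , E₃≈) =
    trans E₁≈ (solve 3 (λ r p q → r :+ p :+ q := r :+ q :+ p) refl r p p′) ,
    trans E₂≈ (solve 4 (λ r p q s → r :* (p :+ q) :+ p :* q :- s := r :* (q :+ p) :+ q :* p :- s) refl r p p′ s) ,
    trans E₃≈ (solve 4 (λ r p q s → r :* (p :* q :- s) := r :* (q :* p :- s)) refl r p p′ s)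

  -- The linear factor of the root r is split off; for m < r the sign is that of the quadratic
  -- factor.
  -cubic-roots : ∀ A {r p p′ s} → HasRoots A r p p′ s → ∀ m →
    (r - m) * ((m - p) * (m - p′) - s) ≈ - cubic (E₁ A) (E₂ A) (E₃ A) m
  -cubic-roots A {r} {p} {p′} {s} (E₁≈ , E₂≈ , E₃≈) m = trans
    (solve 5 (λ r p q s m → (r :- m) :* ((m :- p) :* (m :- q) :- s)
      := :- (m :* m :* m :- (r :+ p :+ q) :* (m :* m) :+ (r :* (p :+ q) :+ p :* q :- s) :* m
             :- r :* (p :* q :- s))) refl r p p′ s m)
    (-‿cong (sym (cubic-cong E₁≈ E₂≈ E₃≈ m)))

  module _ (A : Matrix Carrier 3) (A≥0 : Nonnegative A) {r p p′ s : Carrier}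
           (roots : HasRoots A r p p′ s) (0<r-p : 0# < r - p) (0<r-p′ : 0# < r - p′) where
    private
      m = proj₁ (mean A A≥0)
      0≤m = proj₁ (proj₂ (mean A A≥0))
      3m≈E₁ = proj₂ (proj₂ (mean A A≥0))
      3m≈ : m + m + m ≈ r + p + p′
      3m≈ = trans 3m≈E₁ (proj₁ roots)
      0<r-m : 0# < r - m
      -- 3 (r - m) = (r - p) + (r - p′).
      0<r-m = triple-reflects-0< (0<-resp
        (≈-by 1# 3m≈ (solve 4 (λ r p q m → (r :- p) :+ (r :- q)
          := (r :- m) :+ (r :- m) :+ (r :- m) :+ 1′ :* (m :+ m :+ m :- (r :+ p :+ q))) refl r p p′ m))
        (+-positive 0<r-p (proj₁ 0<r-p′)))
      twin : 0# < (m - p) * (m - p′) - s → IrreducibleTwin A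
      twin pos = negative-at-mean⇒twin A A≥0 m 0≤m 3m≈E₁
        (0<-resp (-cubic-roots A roots m) (*-positive 0<r-m pos))

    -- For a conjugate pair the quadratic factor at the mean is (m - p)² - s, a square plus a
    -- positive number.
    conjugate⇒twin : p ≈ p′ → 0# < - s → IrreducibleTwin A
    conjugate⇒twin p≈p′ 0<-s = twin (0<-resp
      (≈-by (p - m) p≈p′ (solve 4 (λ p q s m → :- s :+ (m :- p) :* (m :- p)
        := (m :- p) :* (m :- q) :- s :+ (p :- m) :* (p :- q)) refl p p′ s m))
      (+-positive 0<-s (0≤x*x (m - p))))

    module _ (s≈0 : s ≈ 0#) (p′≤p : p′ ≤ p) (0≤r+p′ : 0# ≤ r + p′) where
      private
        0<m-p′ : 0# < m - p′
        -- 3 (m - p′) = (r - p′) + (p - p′).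
        0<m-p′ = triple-reflects-0< (0<-resp
          (≈-by (- 1#) 3m≈ (solve 4 (λ r p q m → (r :- q) :+ (p :- q)
            := (m :- q) :+ (m :- q) :+ (m :- q) :+ :- 1′ :* (m :+ m :+ m :- (r :+ p :+ q))) refl r p p′ m))
          (+-positive 0<r-p′ (x≤y⇒0≤y-x p′≤p)))

        p<m⇒twin : p < m → IrreducibleTwin A
        p<m⇒twin p<m = twin (0<-resp
          (≈-by 1# s≈0 (solve 4 (λ p q s m → (m :- p) :* (m :- q)
            := (m :- p) :* (m :- q) :- s :+ 1′ :* (s :- 0′)) refl p p′ s m))
          (*-positive (x<y⇒0<y-x p<m) 0<m-p′))

        module _ (m≤p : m ≤ p) where
          0<p-p′ : 0# < p - p′
          0<p-p′ = 0<-resp (solve 3 (λ m p q → (m :- q) :+ (p :- m) := p :- q) refl m p p′)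
            (+-positive 0<m-p′ (x≤y⇒0≤y-x m≤p))

          0≤p : 0# ≤ p
          0≤p = ≤-trans 0≤m m≤p

          -- Equal corner entries p and equal weights t give the characteristic polynomial (z - p)
          -- ((z - p) (z - b) - 2t). The quadratic has roots r and p′ when b = r + p′ - p and 2t =
          -- pb - rp′ = (r - p) (p - p′).
          p≤r+p′⇒twin : p ≤ r + p′ → IrreducibleTwin A
          p≤r+p′⇒twin p≤r+p′ =
            family p b p t 0# t ,
            family-nonnegative 0≤p (x≤y⇒0≤y-x p≤r+p′) 0≤p (proj₁ 0<t) ≤-refl (proj₁ 0<t) ,
            family-irreducible (inj₂ (0<t , 0<t)) ,
            ( trans (proj₁ roots) (solve 3 (λ r p q → r :+ p :+ q := p :+ (r :+ q :- p) :+ p) refl r p p′)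
            , trans (proj₁ (proj₂ roots)) (sym (trans (E₂-family p b p t 0# t)
                (≈-by 1# s≈0 (≈-by (- ((r - p) * (p - p′))) 2h≈1 (solve 5 (λ r p q s h →
                  let b = r :+ q :- p
                      w = (r :- p) :* (p :- q)
                  in p :* b :+ p :* p :+ b :* p :- h :* w :- h :* w
                     := r :* (p :+ q) :+ p :* q :- s :+ 1′ :* (s :- 0′)
                        :+ :- w :* ((1′ :+ 1′) :* h :- 1′)) refl r p p′ s h)))))
            , trans (proj₂ (proj₂ roots)) (sym (trans (E₃-family p b p t 0# t)
                (≈-by r s≈0 (≈-by (- (p * ((r - p) * (p - p′)))) 2h≈1 (solve 5 (λ r p q s h →
                  let b = r :+ q :- p
                      w = (r :- p) :* (p :- q)
                  in p :* b :* p :- p :* (h :* w) :- p :* (h :* w) :+ 0′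
                     := r :* (p :* q :- s) :+ r :* (s :- 0′)
                        :+ :- (p :* w) :* ((1′ :+ 1′) :* h :- 1′)) refl r p p′ s h)))))
            )
            where
            h = proj₁ half
            2h≈1 = proj₂ (proj₂ half)
            b = r + p′ - p
            t = h * ((r - p) * (p - p′))
            0<t : 0# < t
            0<t = *-positive (proj₁ (proj₂ half)) (*-positive 0<r-p 0<p-p′)

          -- Matching the values of the characteristic polynomials at a and at c
          -- forces the values of t and v.
          r+p′<p⇒twin : r + p′ < p → 0# < r + p′ → IrreducibleTwin A
          -- This choice of ε makes a = r + p′ - ε positive and keeps c = p + ε below r.
          r+p′<p⇒twin r+p′<p 0<r+p′ with common-lower-bound 0<r-p 0<r+p′
          ... | ε , 0<ε , 0<r-p-ε , 0<a =
            family a 0# c t 0# v ,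
            family-nonnegative (proj₁ 0<a) ≤-refl (+-nonNegative 0≤p (proj₁ 0<ε)) (proj₁ 0<t) ≤-refl (proj₁ 0<v) ,
            family-irreducible (inj₂ (0<t , 0<v)) ,
            ( trans (proj₁ roots) (solve 4 (λ r p q ε →
                r :+ p :+ q := (r :+ q :- ε) :+ 0′ :+ (p :+ ε)) refl r p p′ ε)
            , trans (proj₁ (proj₂ roots)) (sym (trans (E₂-family a 0# c t 0# v)
                (≈-by 1# s≈0 (≈-by (- (a * c - (r * (p + p′) + p * p′))) dg≈1 (solve 6 (λ r p q s ε g →
                  let a = r :+ q :- ε
                      c = p :+ ε
                      k = p :- (r :+ q)
                      d = k :+ ε :+ ε
                      t = g :* (((r :- p) :+ (k :+ ε)) :* (k :+ ε) :* ((r :- p :- ε) :+ p))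
                      v = g :* ((r :- p :- ε) :* ε :* ((p :- q) :+ ε))
                  in a :* 0′ :+ a :* c :+ 0′ :* c :- t :- v
                     := r :* (p :+ q) :+ p :* q :- s :+ 1′ :* (s :- 0′)
                        :+ :- (a :* c :- (r :* (p :+ q) :+ p :* q)) :* (d :* g :- 1′)) refl r p p′ s ε g)))))
            , trans (proj₂ (proj₂ roots)) (sym (trans (E₃-family a 0# c t 0# v)
                (≈-by r s≈0 (≈-by (r * (p * p′)) dg≈1 (solve 6 (λ r p q s ε g →
                  let a = r :+ q :- ε
                      c = p :+ ε
                      k = p :- (r :+ q)
                      d = k :+ ε :+ ε
                      t = g :* (((r :- p) :+ (k :+ ε)) :* (k :+ ε) :* ((r :- p :- ε) :+ p))
                      v = g :* ((r :- p :- ε) :* ε :* ((p :- q) :+ ε))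
                  in a :* 0′ :* c :- a :* v :- c :* t :+ 0′
                     := r :* (p :* q :- s) :+ r :* (s :- 0′)
                        :+ (r :* (p :* q)) :* (d :* g :- 1′)) refl r p p′ s ε g)))))
            )
            where
            a = r + p′ - ε
            c = p + ε
            k = p - (r + p′)
            0<k : 0# < k
            0<k = x<y⇒0<y-x r+p′<p
            -- This is c - a.
            d = k + ε + ε
            d-reciprocal = reciprocal (+-positive (+-positive 0<k (proj₁ 0<ε)) (proj₁ 0<ε))
            g = proj₁ d-reciprocal
            0<g = proj₁ (proj₂ d-reciprocal)
            dg≈1 = proj₂ (proj₂ d-reciprocal)
            -- These are t = (r - a) (p - a) (a - p′) / (c - a) and v = (r - c) (c - p) (c - p′) /
            -- (c - a), with factors written as sums of visibly nonnegative terms.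
            t = g * (((r - p) + (k + ε)) * (k + ε) * ((r - p - ε) + p))
            v = g * ((r - p - ε) * ε * ((p - p′) + ε))
            0<k+ε = +-positive 0<k (proj₁ 0<ε)
            0<t : 0# < t
            0<t = *-positive 0<g (*-positive (*-positive (+-positive 0<r-p (proj₁ 0<k+ε)) 0<k+ε)
              (+-positive 0<r-p-ε 0≤p))
            0<v : 0# < v
            0<v = *-positive 0<g (*-positive (*-positive 0<r-p-ε 0<ε) (+-positive 0<p-p′ (proj₁ 0<ε)))

      -- The three constructions cover p < m, m ≤ p ≤ r + p′ and 0 < r + p′ < p. What remains is r +
      -- p′ = 0, where p > r + p′ makes p positive.
      real⇒twin⊎exceptional : IrreducibleTwin A ⊎ (0# < p × r + p′ ≈ 0#)
      real⇒twin⊎exceptional with m ≤? p | p ≤? (r + p′) | (r + p′) ≟ 0#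
      ... | no m≰p  | _        | _        = inj₁ (p<m⇒twin (≰⇒> m≰p))
      ... | yes m≤p | yes p≤   | _        = inj₁ (p≤r+p′⇒twin m≤p p≤)
      ... | yes m≤p | no p≰    | no r+p′≉0 =
        inj₁ (r+p′<p⇒twin m≤p (≰⇒> p≰) (0≤r+p′ , λ 0≈ → r+p′≉0 (sym 0≈)))
      ... | yes m≤p | no p≰    | yes r+p′≈0 = inj₂
        ( (0≤p m≤p , λ 0≈p → p≰ (≤-reflexive (trans (sym 0≈p) (sym r+p′≈0)))) , r+p′≈0)

-- Every nonnegative matrix with eigenvalues a, b, -a, where a > b > 0, is reducible.

module ExceptionalSpectrum (ℝ : CompleteOrderedField) where
  open CompleteOrderedField ℝ
  open Spectra ℝ
  open SquareRoot ℝ using (+-nonNegative; x≤y⇒0≤y-x; +-zero⇒zero; *-zero⇒zero)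
  open Order ℝ
  open Reducibility ℝ
  open IntegerCoefficients commutativeRing
  open LinearCombination commutativeRing
  open Cubic commutativeRing
  open ComplexPolynomials ℝ using (vieta-parts; HasSameE)

  private
    0′ 1′ : ∀ {n} → Polynomial n
    0′ = con (+ 0)
    1′ = con (+ 1)

  relabel : Permutation′ 3 → Matrix Carrier 3 → Matrix Carrier 3
  relabel π A i j = A (π ⟨$⟩ʳ i) (π ⟨$⟩ʳ j)

  relabel-reducible : ∀ π A → IsReducible (relabel π A) → IsReducible A
  relabel-reducible π A (π′ , k , 0<k , k<3 , zero-block) = π′ ∘ₚ π , k , 0<k , k<3 , zero-block

  -- Permutation similarity keeps the characteristic polynomial. This transposition and the next
  -- bring a largest diagonal entry to index 0.
  relabel-01 : ∀ A → HasSameE (relabel (transpose 0F 1F) A) A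
  relabel-01 A =
    solve 3 (λ a e i → e :+ a :+ i := a :+ e :+ i) refl (A 0F 0F) (A 1F 1F) (A 2F 2F)
    ,
    solve 9 (λ a b c d e f g h i →
      (e :* a :- d :* b) :+ (e :* i :- f :* h) :+ (a :* i :- c :* g)
      := (a :* e :- b :* d) :+ (a :* i :- c :* g) :+ (e :* i :- f :* h))
      refl (A 0F 0F) (A 0F 1F) (A 0F 2F) (A 1F 0F) (A 1F 1F) (A 1F 2F) (A 2F 0F) (A 2F 1F) (A 2F 2F)
    ,
    solve 9 (λ a b c d e f g h i →
      e :* (a :* i :- c :* g) :- d :* (b :* i :- c :* h) :+ f :* (b :* g :- a :* h)
      := a :* (e :* i :- f :* h) :- b :* (d :* i :- f :* g) :+ c :* (d :* h :- e :* g))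
      refl (A 0F 0F) (A 0F 1F) (A 0F 2F) (A 1F 0F) (A 1F 1F) (A 1F 2F) (A 2F 0F) (A 2F 1F) (A 2F 2F)

  relabel-02 : ∀ A → HasSameE (relabel (transpose 0F 2F) A) A
  relabel-02 A =
    solve 3 (λ a e i → i :+ e :+ a := a :+ e :+ i) refl (A 0F 0F) (A 1F 1F) (A 2F 2F)
    ,
    solve 9 (λ a b c d e f g h i →
      (i :* e :- h :* f) :+ (i :* a :- g :* c) :+ (e :* a :- d :* b)
      := (a :* e :- b :* d) :+ (a :* i :- c :* g) :+ (e :* i :- f :* h))
      refl (A 0F 0F) (A 0F 1F) (A 0F 2F) (A 1F 0F) (A 1F 1F) (A 1F 2F) (A 2F 0F) (A 2F 1F) (A 2F 2F)
    ,
    solve 9 (λ a b c d e f g h i →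
      i :* (e :* a :- d :* b) :- h :* (f :* a :- d :* c) :+ g :* (f :* b :- e :* c)
      := a :* (e :* i :- f :* h) :- b :* (d :* i :- f :* g) :+ c :* (d :* h :- e :* g))
      refl (A 0F 0F) (A 0F 1F) (A 0F 2F) (A 1F 0F) (A 1F 1F) (A 1F 2F) (A 2F 0F) (A 2F 1F) (A 2F 2F)

  +-zero⇒zeros : ∀ {x y} → 0# ≤ x → 0# ≤ y → x + y ≈ 0# → x ≈ 0# × y ≈ 0#
  +-zero⇒zeros 0≤x 0≤y x+y≈0 =
    +-zero⇒zero 0≤x 0≤y x+y≈0 , +-zero⇒zero 0≤y 0≤x (trans (+-comm _ _) x+y≈0)

  -- If the edge 0 → 1 exists, then 1 → 0 does not, and 1 → 2 or 2 → 0 is missing: either 1 has no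
  -- exit or 0 has no entry. The edge 0 → 2 is symmetric, and without both edges 0 has no exit.
  no-cycle-through-0⇒reducible : ∀ (A : Matrix Carrier 3) →
    A 0F 1F * A 1F 0F ≈ 0# → A 0F 2F * A 2F 0F ≈ 0# →
    A 0F 1F * (A 1F 2F * A 2F 0F) ≈ 0# → A 0F 2F * (A 2F 1F * A 1F 0F) ≈ 0# →
    IsReducible A
  no-cycle-through-0⇒reducible A p01≈0 p02≈0 c≈0 c′≈0 with A 0F 1F ≟ 0# | A 0F 2F ≟ 0#
  ... | yes A01≈0 | yes A02≈0 = noExit⇒reducible A 0F λ where
    0F 0≢0 → contradiction ≡.refl 0≢0
    1F _ → A01≈0
    2F _ → A02≈0
  ... | no A01≉0 | _ = [ exitless-1 , entryless-0 ]′ (x*y≈0⇒x≈0⊎y≈0 (*-zero⇒zero A01≉0 c≈0))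
    where
    exitless-1 : A 1F 2F ≈ 0# → IsReducible A
    exitless-1 A12≈0 = noExit⇒reducible A 1F λ where
      0F _ → *-zero⇒zero A01≉0 p01≈0
      1F 1≢1 → contradiction ≡.refl 1≢1
      2F _ → A12≈0
    entryless-0 : A 2F 0F ≈ 0# → IsReducible A
    entryless-0 A20≈0 = noEntry⇒reducible A 0F λ where
      0F 0≢0 → contradiction ≡.refl 0≢0
      1F _ → *-zero⇒zero A01≉0 p01≈0
      2F _ → A20≈0
  ... | yes _ | no A02≉0 = [ exitless-2 , entryless-0 ]′ (x*y≈0⇒x≈0⊎y≈0 (*-zero⇒zero A02≉0 c′≈0))
    where
    exitless-2 : A 2F 1F ≈ 0# → IsReducible A
    exitless-2 A21≈0 = noExit⇒reducible A 2F λ where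
      0F _ → *-zero⇒zero A02≉0 p02≈0
      1F _ → A21≈0
      2F 2≢2 → contradiction ≡.refl 2≢2
    entryless-0 : A 1F 0F ≈ 0# → IsReducible A
    entryless-0 A10≈0 = noEntry⇒reducible A 0F λ where
      0F 0≢0 → contradiction ≡.refl 0≢0
      1F _ → A10≈0
      2F _ → *-zero⇒zero A02≉0 p02≈0

  module _ {a b : Carrier} (b<a : b < a) (0<b : 0# < b) where

    HasExceptionalE : Matrix Carrier 3 → Set
    HasExceptionalE A = E₁ A ≈ b × E₂ A ≈ - (a * a) × E₃ A ≈ - (a * a * b)

    -- The terms `T₁` to `T₅` are nonnegative with sum 0, so each vanishes. `T₁` and `T₂` are the
    -- 3-cycles; `T₅` gives y = z = 0, hence x = b > 0, after which `T₃` and `T₄` kill the 2-cycles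
    -- through 0.
    no-cycle-through-0 : ∀ A → Nonnegative A → HasExceptionalE A →
      A 1F 1F ≤ A 0F 0F → A 2F 2F ≤ A 0F 0F →
      A 0F 1F * A 1F 0F ≈ 0# × A 0F 2F * A 2F 0F ≈ 0# ×
      A 0F 1F * (A 1F 2F * A 2F 0F) ≈ 0# × A 0F 2F * (A 2F 1F * A 1F 0F) ≈ 0#
    no-cycle-through-0 A A≥0 (E₁≈ , E₂≈ , E₃≈) y≤x z≤x =
      *-zero⇒zero (0<⇒≉0 0<x-z) (trans (*-comm _ _) T₄≈0) ,
      *-zero⇒zero (0<⇒≉0 0<x-y) (trans (*-comm _ _) T₃≈0) ,
      T₁≈0 , T₂≈0
      where
      x = A 0F 0F
      y = A 1F 1F
      z = A 2F 2F
      A01 = A 0F 1F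
      A02 = A 0F 2F
      A10 = A 1F 0F
      A12 = A 1F 2F
      A20 = A 2F 0F
      A21 = A 2F 1F
      T₁ = A01 * (A12 * A20)
      T₂ = A02 * (A21 * A10)
      T₃ = A02 * A20 * (x - y)
      T₄ = A01 * A10 * (x - z)
      w = (a - x) * (a + x)
      T₅ = (y + z) * w
      p01 = A01 * A10
      p02 = A02 * A20
      p12 = A12 * A21
      c = T₁ + T₂
      e₂ = x * y + x * z + y * z - p01 - p02 - p12
      e₃ = x * y * z - x * p12 - y * p02 - z * p01 + c
      e₂≈ : e₂ ≈ - (a * a)
      e₂≈ = trans (solve 6 (λ x y z p q r →
        x :* y :+ x :* z :+ y :* z :- p :- q :- r
        := (x :* y :- p) :+ (x :* z :- q) :+ (y :* z :- r)) refl x y z p01 p02 p12) E₂≈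
      e₃≈ : e₃ ≈ - (a * a * b)
      e₃≈ = trans (solve 9 (λ a b c d e f g h i →
        a :* e :* i :- a :* (f :* h) :- e :* (c :* g) :- i :* (b :* d) :+ (b :* (f :* g) :+ c :* (h :* d))
        := a :* (e :* i :- f :* h) :- b :* (d :* i :- f :* g) :+ c :* (d :* h :- e :* g))
        refl x A01 A02 A10 y A12 A20 A21 z) E₃≈
      T≈0 : T₁ + T₂ + T₃ + T₄ + T₅ ≈ 0#
      -- In e₃ - e₁ e₂ = 0, expand e₃ - x e₂ and replace e₂ by -a² in the remaining -(y + z) e₂.
      T≈0 = ≈-by 1# e₃≈ (≈-by (a * a) E₁≈ (≈-by (y + z - (x + y + z)) e₂≈
        (solve 9 (λ c r q p b a x y z →
          let e₁ = x :+ y :+ z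
              e₂ = x :* y :+ x :* z :+ y :* z :- p :- q :- r
              e₃ = x :* y :* z :- x :* r :- y :* q :- z :* p :+ c
          in c :+ q :* (x :- y) :+ p :* (x :- z) :+ (y :+ z) :* ((a :- x) :* (a :+ x))
             := 0′ :+ 1′ :* (e₃ :- :- (a :* a :* b)) :+ a :* a :* (e₁ :- b)
                  :+ (y :+ z :- e₁) :* (e₂ :- :- (a :* a)))
          refl c p12 p02 p01 b a x y z)))
      0≤T₁ : 0# ≤ T₁
      0≤T₁ = *-nonNegative (A≥0 _ _) (*-nonNegative (A≥0 _ _) (A≥0 _ _))
      0≤T₂ : 0# ≤ T₂
      0≤T₂ = *-nonNegative (A≥0 _ _) (*-nonNegative (A≥0 _ _) (A≥0 _ _))
      0≤T₃ : 0# ≤ T₃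
      0≤T₃ = *-nonNegative (*-nonNegative (A≥0 _ _) (A≥0 _ _)) (x≤y⇒0≤y-x y≤x)
      0≤T₄ : 0# ≤ T₄
      0≤T₄ = *-nonNegative (*-nonNegative (A≥0 _ _) (A≥0 _ _)) (x≤y⇒0≤y-x z≤x)
      0<a-b : 0# < a - b
      0<a-b = x<y⇒0<y-x b<a
      0<w : 0# < w
      -- Both factors are positive because 0 ≤ x ≤ x + y + z = b < a.
      0<w = *-positive
        (0<-resp (≈-by 1# E₁≈ (solve 5 (λ a b x y z →
          (a :- b) :+ (y :+ z) := a :- x :+ 1′ :* (x :+ y :+ z :- b)) refl a b x y z))
          (+-positive 0<a-b (+-nonNegative (A≥0 1F 1F) (A≥0 2F 2F))))
        (0<-resp (solve 3 (λ a b x → (a :- b) :+ b :+ x := a :+ x) refl a b x)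
          (+-positive (+-positive 0<a-b (proj₁ 0<b)) (A≥0 0F 0F)))
      0≤y+z = +-nonNegative (A≥0 1F 1F) (A≥0 2F 2F)
      0≤T₅ : 0# ≤ T₅
      0≤T₅ = *-nonNegative 0≤y+z (proj₁ 0<w)
      0≤T₁₂ = +-nonNegative 0≤T₁ 0≤T₂
      0≤T₁₂₃ = +-nonNegative 0≤T₁₂ 0≤T₃
      split₅ = +-zero⇒zeros (+-nonNegative 0≤T₁₂₃ 0≤T₄) 0≤T₅ T≈0
      split₄ = +-zero⇒zeros 0≤T₁₂₃ 0≤T₄ (proj₁ split₅)
      split₃ = +-zero⇒zeros 0≤T₁₂ 0≤T₃ (proj₁ split₄)
      split₂ = +-zero⇒zeros 0≤T₁ 0≤T₂ (proj₁ split₃)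
      T₁≈0 = proj₁ split₂
      T₂≈0 = proj₂ split₂
      T₃≈0 = proj₂ split₃
      T₄≈0 = proj₂ split₄
      y+z≈0 : y + z ≈ 0#
      y+z≈0 = *-zero⇒zero (0<⇒≉0 0<w) (trans (*-comm _ _) (proj₂ split₅))
      y≈0,z≈0 = +-zero⇒zeros (A≥0 1F 1F) (A≥0 2F 2F) y+z≈0
      0<x-y : 0# < x - y
      0<x-y = 0<-resp (≈-by (- 1#) E₁≈ (≈-by 1# y+z≈0 (≈-by 1# (proj₁ y≈0,z≈0) (solve 4 (λ b x y z →
        b := x :- y :+ :- 1′ :* (x :+ y :+ z :- b) :+ 1′ :* (y :+ z :- 0′) :+ 1′ :* (y :- 0′))
        refl b x y z)))) 0<b
      0<x-z : 0# < x - z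
      0<x-z = 0<-resp (≈-by (- 1#) E₁≈ (≈-by 1# y+z≈0 (≈-by 1# (proj₂ y≈0,z≈0) (solve 4 (λ b x y z →
        b := x :- z :+ :- 1′ :* (x :+ y :+ z :- b) :+ 1′ :* (y :+ z :- 0′) :+ 1′ :* (z :- 0′))
        refl b x y z)))) 0<b

    dominant-0⇒reducible : ∀ A → Nonnegative A → HasExceptionalE A →
      A 1F 1F ≤ A 0F 0F → A 2F 2F ≤ A 0F 0F → IsReducible A
    dominant-0⇒reducible A A≥0 E≈ y≤x z≤x =
      let (p01≈0 , p02≈0 , c≈0 , c′≈0) = no-cycle-through-0 A A≥0 E≈ y≤x z≤x in
      no-cycle-through-0⇒reducible A p01≈0 p02≈0 c≈0 c′≈0

    -- The index of a largest diagonal entry is moved to 0; reducibility and the coefficients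
    -- survive relabelling.
    exceptional-E⇒reducible : ∀ A → Nonnegative A → HasExceptionalE A → IsReducible A
    exceptional-E⇒reducible A A≥0 (E₁≈ , E₂≈ , E₃≈)
      with total (A 1F 1F) (A 0F 0F) | total (A 2F 2F) (A 0F 0F) | total (A 2F 2F) (A 1F 1F)
    ... | inj₁ y≤x | inj₁ z≤x | _ = dominant-0⇒reducible A A≥0 (E₁≈ , E₂≈ , E₃≈) y≤x z≤x
    ... | inj₂ x≤y | _ | inj₁ z≤y =
      let (e₁ , e₂ , e₃) = relabel-01 A in
      relabel-reducible (transpose 0F 1F) A
        (dominant-0⇒reducible (relabel (transpose 0F 1F) A) (λ _ _ → A≥0 _ _)
          (trans e₁ E₁≈ , trans e₂ E₂≈ , trans e₃ E₃≈) x≤y z≤y)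
    ... | inj₂ x≤y | _ | inj₂ y≤z =
      let (e₁ , e₂ , e₃) = relabel-02 A in
      relabel-reducible (transpose 0F 2F) A
        (dominant-0⇒reducible (relabel (transpose 0F 2F) A) (λ _ _ → A≥0 _ _)
          (trans e₁ E₁≈ , trans e₂ E₂≈ , trans e₃ E₃≈) y≤z (≤-trans x≤y y≤z))
    ... | inj₁ y≤x | inj₂ x≤z | _ =
      let (e₁ , e₂ , e₃) = relabel-02 A in
      relabel-reducible (transpose 0F 2F) A
        (dominant-0⇒reducible (relabel (transpose 0F 2F) A) (λ _ _ → A≥0 _ _)
          (trans e₁ E₁≈ , trans e₂ E₂≈ , trans e₃ E₃≈) (≤-trans y≤x x≤z) x≤z)

    exceptional-eigenvalues⇒reducible : ∀ A → Nonnegative A →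
      HasEigenvalues A (fromℝ a ∷ fromℝ b ∷ fromℝ (- a) ∷ []) → IsReducible A
    exceptional-eigenvalues⇒reducible A A≥0 eig =
      let ((E₁≈ , E₂≈ , E₃≈) , _) = vieta-parts A a b 0# (- a) 0# eig in
      exceptional-E⇒reducible A A≥0
      ( trans E₁≈ (solve 2 (λ a b → a :+ b :+ :- a := b) refl a b)
      , trans E₂≈ (solve 2 (λ a b → a :* (b :+ :- a) :+ b :* :- a :- 0′ :* 0′ := :- (a :* a)) refl a b)
      , trans E₃≈ (solve 2 (λ a b → a :* (b :* :- a :- 0′ :* 0′) := :- (a :* a :* b)) refl a b) )

-- Lists whose spectral radius is a simple element.

module SimplePerronRoot (ℝ : CompleteOrderedField) where
  open CompleteOrderedField ℝ
  open Spectra ℝ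
  open SquareRoot ℝ using
    ( √-exists; +-nonNegative; x≤y⇒0≤y-x; +-zero⇒zero; *-zero⇒zero; 0≤x*x
    ; y≈x+d⇒x≤y; square-reflects-≤; x+[y-x]≈y; -x*-x≈x*x )
  open Order ℝ
  open IntegerCoefficients commutativeRing
  open LinearCombination commutativeRing
  open ComplexPolynomials ℝ
  open Realization ℝ
  open RingProperties ring using (-‿involutive)
  open NaturalMax totalOrder using (x≤x⊔y; x≤y⊔x)
  private
    module ℂR = CommutativeRing ℂ-commutativeRing
    module ℂ↭ = PermutationProperties ℂR.setoid
  open PermutationSetoid ℂR.setoid using (↭-trans; ↭-refl; ↭-prep; ↭-swap; prep; ↭-reflexive-≋)

  private
    0′ 1′ : ∀ {n} → Polynomial n
    0′ = con (+ 0)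
    1′ = con (+ 1)

  -- The bound on the modulus is squared, which keeps square roots out of the arithmetic.
  Bounded : Carrier → ℂ → Set
  Bounded r z = re z * re z + im z * im z ≤ r * r

  Bounded-resp : ∀ {r z w} → z ≈ℂ w → Bounded r z → Bounded r w
  Bounded-resp (re≈ , im≈) = ≤-respˡ (+-cong (*-cong re≈ re≈) (*-cong im≈ im≈))

  ∣∣≤⇒Bounded : ∀ {r} z → 0# ≤ r → ∣ z ∣ ≤ r → Bounded r z
  ∣∣≤⇒Bounded {r} (x +i y) 0≤r ∣z∣≤r with √-exists (x * x + y * y) (+-nonNegative (0≤x*x x) (0≤x*x y))
  ... | m , 0≤m , m²≈ = ≤-respˡ m²≈ (y≈x+d⇒x≤y ((r - m) * (r + m))
    (*-nonNegative (x≤y⇒0≤y-x ∣z∣≤r) (+-nonNegative 0≤r 0≤m))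
    (solve 2 (λ r m → m :* m :+ (r :- m) :* (r :+ m) := r :* r) refl r m))

  square-bound : ∀ {r x} → 0# ≤ r → x * x ≤ r * r → x ≤ r
  square-bound {r} {x} 0≤r x²≤r² with total 0# x
  ... | inj₁ 0≤x = square-reflects-≤ 0≤x 0≤r x²≤r²
  ... | inj₂ x≤0 = ≤-trans x≤0 0≤r

  module _ {r : Carrier} (0≤r : 0# ≤ r) {x y : Carrier} (bounded : Bounded r (x +i y)) where
    private
      x²≤r² : x * x ≤ r * r
      x²≤r² = ≤-trans (y≈x+d⇒x≤y (y * y) (0≤x*x y) refl) bounded

    Bounded⇒re≤ : x ≤ r
    Bounded⇒re≤ = square-bound 0≤r x²≤r²

    Bounded⇒-≤re : 0# ≤ r + x
    Bounded⇒-≤re = ≤-respʳ (+-congˡ (-‿involutive x))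
      (x≤y⇒0≤y-x (square-bound 0≤r (≤-respˡ (sym (-x*-x≈x*x x)) x²≤r²)))

    -- A point of the disc of radius r with real part r has imaginary part 0, so it is r itself.
    Bounded⇒re< : ¬ (x +i y) ≈ℂ fromℝ r → 0# < r - x
    Bounded⇒re< z≉r = x<y⇒0<y-x (Bounded⇒re≤ , λ x≈r → z≉r (x≈r , y≈0 x≈r))
      where
      y≈0 : x ≈ r → y ≈ 0#
      y≈0 x≈r with y ≟ 0#
      ... | yes y≈0 = y≈0
      ... | no  y≉0 = *-zero⇒zero y≉0 (+-zero⇒zero (0≤x*x y) (x≤y⇒0≤y-x bounded)
        (≈-by (- (x + r)) x≈r (solve 3 (λ x y r →
          y :* y :+ (r :* r :- (x :* x :+ y :* y)) := 0′ :+ :- (x :+ r) :* (x :- r)) refl x y r)))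

  exceptional : ∀ {r p q p′ q′} → 0# < r - p → q ≈ 0# → q′ ≈ 0# → 0# < p → r + p′ ≈ 0# →
    IsExceptional (fromℝ r ∷ (p +i q) ∷ (p′ +i q′) ∷ [])
  exceptional {r} {p} {q} {p′} (0≤r-p , 0≉r-p) q≈0 q′≈0 0<p r+p′≈0 = r , p ,
    (y≈x+d⇒x≤y (r - p) 0≤r-p (x+[y-x]≈y p r) ,
     λ p≈r → 0≉r-p (sym (trans (+-congˡ (-‿cong p≈r)) (-‿inverseʳ r)))) ,
    0<p , ↭-reflexive-≋ (ℂR.refl ∷ (refl , q≈0) ∷ (p′≈-r , q′≈0) ∷ [])
    where
    p′≈-r : p′ ≈ - r
    p′≈-r = ≈-by 1# r+p′≈0 (solve 2 (λ r p → p := :- r :+ 1′ :* (r :+ p :- 0′)) refl r p′)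

  module _ (A : Matrix Carrier 3) (A≥0 : Nonnegative A) {r p q p′ q′ : Carrier} (0≤r : 0# ≤ r)
           (z≤r : Bounded r (p +i q)) (w≤r : Bounded r (p′ +i q′))
           (z≉r : ¬ (p +i q) ≈ℂ fromℝ r) (w≉r : ¬ (p′ +i q′) ≈ℂ fromℝ r) where
    private
      σ : List ℂ
      σ = fromℝ r ∷ (p +i q) ∷ (p′ +i q′) ∷ []
      0<r-p = Bounded⇒re< 0≤r z≤r z≉r
      0<r-p′ = Bounded⇒re< 0≤r w≤r w≉r

    -- If q is nonzero, the last two roots are conjugate and -qq′ = q² > 0. Otherwise all roots are
    -- real, and they are ordered so that the smaller of p and p′ comes last.
    roots⇒twin⊎exceptional : HasRoots A r p p′ (q * q′) → q + q′ ≈ 0# → q * (p - p′) ≈ 0# →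
      IrreducibleTwin A ⊎ IsExceptional σ
    roots⇒twin⊎exceptional roots q+q′≈0 q[p-p′]≈0 with q ≟ 0# | total p′ p
    ... | no q≉0 | _ =
      inj₁ (conjugate⇒twin A A≥0 roots 0<r-p 0<r-p′ p≈p′ 0<-qq′)
      where
      p≈p′ : p ≈ p′
      p≈p′ = ≈-by 1# (*-zero⇒zero q≉0 q[p-p′]≈0)
        (solve 2 (λ p q → p := q :+ 1′ :* (p :- q :- 0′)) refl p p′)
      0<-qq′ : 0# < - (q * q′)
      0<-qq′ = 0<-resp
        (≈-by q q+q′≈0 (solve 2 (λ q q′ → q :* q := :- (q :* q′) :+ q :* (q :+ q′ :- 0′)) refl q q′))
        (0≤x*x q , λ 0≈q² → q≉0 (*-zero⇒zero q≉0 (sym 0≈q²)))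
    ... | yes q≈0 | inj₁ p′≤p = map₂
      (λ (0<p , r+p′≈0) → exceptional 0<r-p q≈0 q′≈0 0<p r+p′≈0)
      (real⇒twin⊎exceptional A A≥0 roots 0<r-p 0<r-p′ qq′≈0 p′≤p (Bounded⇒-≤re 0≤r w≤r))
      where
      q′≈0 = trans (sym (+-identityˡ q′)) (trans (+-congʳ (sym q≈0)) q+q′≈0)
      qq′≈0 = trans (*-congʳ q≈0) (zeroˡ q′)
    ... | yes q≈0 | inj₂ p≤p′ = map₂
      (λ (0<p′ , r+p≈0) →
        let (a , b , b<a , 0<b , perm) = exceptional {q = q′} {q′ = q} 0<r-p′ q′≈0 q≈0 0<p′ r+p≈0
        in a , b , b<a , 0<b , ↭-trans (↭-prep (fromℝ r) (↭-swap _ _ ↭-refl)) perm)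
      (real⇒twin⊎exceptional A A≥0 (HasRoots-swap A roots) 0<r-p′ 0<r-p qq′≈0 p≤p′ (Bounded⇒-≤re 0≤r z≤r))
      where
      q′≈0 = trans (sym (+-identityˡ q′)) (trans (+-congʳ (sym q≈0)) q+q′≈0)
      qq′≈0 = trans (*-congʳ q≈0) (zeroˡ q′)

    twin⊎exceptional : HasEigenvalues A σ → IrreducibleTwin A ⊎ IsExceptional σ
    twin⊎exceptional eig =
      let (roots , q+q′≈0 , q[p-p′]≈0) = vieta-parts A r p q p′ q′ eig in
      roots⇒twin⊎exceptional roots q+q′≈0 q[p-p′]≈0

  -- Isolating the simple element and passing to arbitrary orderings.

  multiplicity-accept : ∀ {z x} σ → x ≈ℂ z → multiplicity z (x ∷ σ) ≡ ℕ.suc (multiplicity z σ)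
  multiplicity-accept {z} σ x≈z = ≡.cong length (filter-accept (_≟ℂ z) x≈z)

  multiplicity-reject : ∀ {z x} σ → ¬ x ≈ℂ z → multiplicity z (x ∷ σ) ≡ multiplicity z σ
  multiplicity-reject {z} σ x≉z = ≡.cong length (filter-reject (_≟ℂ z) x≉z)

  multiplicity≡0⇒absent : ∀ z σ → multiplicity z σ ≡ 0 → All (λ x → ¬ x ≈ℂ z) σ
  multiplicity≡0⇒absent z []      _  = []
  multiplicity≡0⇒absent z (x ∷ σ) eq with x ≟ℂ z
  ... | yes x≈z = contradiction (≡.trans (≡.sym (multiplicity-accept σ x≈z)) eq) λ ()
  ... | no  x≉z = x≉z ∷ multiplicity≡0⇒absent z σ (≡.trans (≡.sym (multiplicity-reject σ x≉z)) eq)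

  multiplicity≡1⇒simple : ∀ z σ → multiplicity z σ ≡ 1 →
    ∃ λ τ → σ ↭ z ∷ τ × All (λ x → ¬ x ≈ℂ z) τ
  multiplicity≡1⇒simple z (x ∷ σ) eq with x ≟ℂ z
  ... | yes x≈z = σ , prep x≈z ↭-refl , multiplicity≡0⇒absent z σ
          (ℕ.suc-injective (≡.trans (≡.sym (multiplicity-accept σ x≈z)) eq))
  ... | no  x≉z =
    let (τ , σ↭z∷τ , absent) = multiplicity≡1⇒simple z σ (≡.trans (≡.sym (multiplicity-reject σ x≉z)) eq)
    in x ∷ τ , ↭-trans (↭-prep x σ↭z∷τ) (↭-swap x z ↭-refl) , x≉z ∷ absent

  ∣∣≤ρ : ∀ σ → All (λ z → ∣ z ∣ ≤ ρ σ) σ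
  ∣∣≤ρ []      = []
  ∣∣≤ρ (z ∷ σ) = x≤x⊔y ∣ z ∣ (ρ σ) ∷ All.map (λ w≤ → ≤-trans w≤ (x≤y⊔x ∣ z ∣ (ρ σ))) (∣∣≤ρ σ)

  realizable⇒irreducibly : ∀ σ → length σ ≡ 3 → 0# ≤ ρ σ → multiplicity (fromℝ (ρ σ)) σ ≡ 1 →
    ¬ IsExceptional σ → Realizable σ → IrreduciblyRealizable σ
  -- The pattern makes `length σ` compute to 3, so that `A` is a 3 × 3 matrix.
  realizable⇒irreducibly σ@(_ ∷ _ ∷ _ ∷ []) ≡.refl 0≤r simple not-exceptional (A , A≥0 , eig) =
    let (τ , σ↭r∷τ , absent) = multiplicity≡1⇒simple (fromℝ r) σ simple in
    realize τ σ↭r∷τ (ℂ↭.xs↭ys⇒|xs|≡|ys| σ↭r∷τ) absent (ℂ↭.All-resp-↭ Bounded-resp σ↭r∷τ bounded)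
    where
    r = ρ σ
    bounded : All (Bounded r) σ
    bounded = All.map (λ {z} → ∣∣≤⇒Bounded z 0≤r) (∣∣≤ρ σ)
    realize : ∀ τ → σ ↭ fromℝ r ∷ τ → 3 ≡ ℕ.suc (length τ) →
      All (λ z → ¬ z ≈ℂ fromℝ r) τ → All (Bounded r) (fromℝ r ∷ τ) → IrreduciblyRealizable σ
    realize (z ∷ w ∷ []) σ↭ ≡.refl (z≉r ∷ w≉r ∷ []) (_ ∷ z≤r ∷ w≤r ∷ []) =
      [ (λ (B , B≥0 , irreducible , same) →
          B , B≥0 , irreducible , HasEigenvalues-transfer A B σ same eig)
      , (λ (a , b , b<a , 0<b , perm) →
          contradiction (a , b , b<a , 0<b , ↭-trans σ↭ perm) not-exceptional)
      ]′ (twin⊎exceptional A A≥0 0≤r z≤r w≤r z≉r w≉r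
            (HasEigenvalues-resp-↭ A σ (fromℝ r ∷ z ∷ w ∷ []) σ↭ eig))

  exceptional⇒¬irreducibly : ∀ σ → length σ ≡ 3 → IsExceptional σ → ¬ IrreduciblyRealizable σ
  exceptional⇒¬irreducibly σ@(_ ∷ _ ∷ _ ∷ []) ≡.refl (a , b , b<a , 0<b , σ↭) (A , A≥0 , irreducible , eig) =
    irreducible (ExceptionalSpectrum.exceptional-eigenvalues⇒reducible ℝ b<a 0<b A A≥0
      (HasEigenvalues-resp-↭ A σ (fromℝ a ∷ fromℝ b ∷ fromℝ (- a) ∷ []) σ↭ eig))

  -- The sum of a, b and -a is b, which is positive.
  zero-sum⇒¬exceptional : ∀ σ → sumℂ σ ≈ℂ fromℝ 0# → ¬ IsExceptional σ
  zero-sum⇒¬exceptional σ sum≈0 (a , b , b<a , (_ , 0≉b) , σ↭) = 0≉b (trans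
    (sym (proj₁ sum≈0))
    (trans (proj₁ (sumℂ-resp-↭ σ↭)) (solve 2 (λ a b → a :+ (b :+ (:- a :+ 0′)) := b) refl a b)))

mainTheorem2 : (ℝ : CompleteOrderedField) →
    let open CompleteOrderedField ℝ
        open Spectra ℝ
    in (σ : List ℂ) → length σ ≡ 3 →
       0# < ρ σ → multiplicity (fromℝ (ρ σ)) σ ≡ 1 →
       (¬ IsExceptional σ → IrreduciblyRealizable σ ⇔ Realizable σ) ×
       (IsExceptional σ → ¬ IrreduciblyRealizable σ) ×
       (sumℂ σ ≈ℂ fromℝ 0# → IrreduciblyRealizable σ ⇔ Realizable σ)
mainTheorem2 ℝ σ length≡3 (0≤ρ , _) simple =
  generic , exceptional⇒¬irreducibly σ length≡3 ,
  λ sum≈0 → generic (zero-sum⇒¬exceptional σ sum≈0)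
  where
  open Spectra ℝ
  open SimplePerronRoot ℝ
  generic : ¬ IsExceptional σ → IrreduciblyRealizable σ ⇔ Realizable σ
  generic not-exceptional = mk⇔
    (λ (A , A≥0 , _ , eig) → A , A≥0 , eig)
    (realizable⇒irreducibly σ length≡3 0≤ρ simple not-exceptional)
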